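{- For all fixed integers $r\geq 3$ and $l\geq 5$ with $l$ odd, there exists a constant $c_{r,l}>0$ such that for all $n$, $$R(C_l^r,K_n^r)\leq c_{r,l}\, n^{1+1/\lfloor l/2\rfloor}.$$
   Context: A loose cycle of length $l$ is a hypergraph with $l$ edges $e_1,\dots,e_l$ such that $|e_i\cap e_j|=1$ whenever $j\equiv i+1$ or $j\equiv i-1 \pmod l$, and $e_i\cap e_j=\emptyset$ otherwise. $C_l^r$ denotes an $r$-uniform loose cycle of length $l$ (all edges have size $r$), and $K_n^r$ denotes the complete $r$-uniform hypergraph on $n$ vertices. The Ramsey number $R(C_l^r,K_n^r)$ is the least integer $N$ such that every red/blue colouring of the edges of $K_N^r$ contains a red copy of $C_l^r$ or a blue copy of $K_n^r$. -}

module Defs where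

open import Data.Nat using (ℕ; zero; suc; _<_)
open import Data.Bool using (Bool; true; false)
open import Data.Fin using (Fin; toℕ)
open import Data.Fin.Subset using (Subset; _∩_; _⊆_; ∣_∣; ⊥)
open import Data.Product using (_×_; Σ; ∃)
open import Data.Sum using (_⊎_)
open import Relation.Binary.PropositionalEquality using (_≡_; _≢_)
open import Relation.Nullary using (¬_)

-- A red/blue colouring of the edges of K_N^r.  Vertices are Fin N, edges are
-- the r-element subsets.  We colour every subset; only values on r-subsets matter.
-- true = red, false = blue.
Colouring : ℕ → Set
Colouring N = Subset N → Bool

red blue : Bool
red = true
blue = false

CycAdj : (l : ℕ) → Fin l → Fin l → Set
CycAdj l i j =
  (toℕ j ≡ suc (toℕ i)) ⊎ (toℕ i ≡ suc (toℕ j))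
  ⊎ ((toℕ j ≡ 0 × suc (toℕ i) ≡ l) ⊎ (toℕ i ≡ 0 × suc (toℕ j) ≡ l))

IsLooseCycle : (r l : ℕ) {N : ℕ} → (Fin l → Subset N) → Set
IsLooseCycle r l e =
  (∀ i → ∣ e i ∣ ≡ r)
  × (∀ i j → i ≢ j →
       (CycAdj l i j → ∣ e i ∩ e j ∣ ≡ 1)
     × (¬ CycAdj l i j → e i ∩ e j ≡ ⊥))

RedLooseCycle : (r l : ℕ) {N : ℕ} → Colouring N → Set
RedLooseCycle r l {N} χ =
  Σ (Fin l → Subset N) λ e → IsLooseCycle r l e × (∀ i → χ (e i) ≡ red)

BlueClique : (r n : ℕ) {N : ℕ} → Colouring N → Set
BlueClique r n {N} χ =
  Σ (Subset N) λ S → (∣ S ∣ ≡ n)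
    × (∀ (e : Subset N) → e ⊆ S → ∣ e ∣ ≡ r → χ e ≡ blue)

Arrows : (r l n N : ℕ) → Set
Arrows r l n N = ∀ (χ : Colouring N) → RedLooseCycle r l χ ⊎ BlueClique r n χ

IsRamseyNumber : (r l n N : ℕ) → Set
IsRamseyNumber r l n N = Arrows r l n N × (∀ M → M < N → ¬ Arrows r l n M)

{-# OPTIONS --safe #-}
module Submission where

-- Replace the red edges by kernels: minimal sets A with at least two vertices such that, whenever
-- few vertices outside A are forbidden, some red edge contains A and avoids them.  Every red edge
-- contains a kernel, a loose cycle of kernels expands greedily to a red loose cycle, and all
-- kernels through a given pair of vertices lie in a set of bounded size.
--
-- From any vertex grow a tree: the next layer is a maximal family of kernels meeting the tree only
-- in one leaf, pairwise disjoint outside the tree.  As N = t^(k+1), some layer of depth at most k has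
-- at most t times as many kernels as the tree has leaves.  If there is no cycle of length 2k + 1,
-- a constant proportion of the leaves is such that no two of them share a kernel otherwise disjoint
-- from the interior of the tree: else some path through leaves, increasing in the lexicographic order of
-- the tree, would contain two leaves whose distance along the path and branching height fit together
-- to a cycle of length 2k + 1.  Keep these leaves, delete the tree together with the next layer, and
-- repeat; this keeps at least N / (c t) = t^k / c vertices and yields a set containing no red edge.

open import Defs
open import Data.Bool using (true; false; if_then_else_)
import Data.Bool.Properties as Boolₚ
open import Data.Empty using (⊥-elim)
open import Data.Fin using (Fin; zero; suc; toℕ; fromℕ<)
import Data.Fin.Properties as Finₚ
open import Data.Fin.Subset using (Subset; _∈_; _∉_; _⊆_; ∣_∣; ⊥; ⁅_⁆; _∪_; _∩_)
open import Data.Fin.Subset.Properties using (anySubset?; _∈?_; _⊆?_; ∉⊥; ∣⊥∣≡0; x∈⁅x⁆; x∈⁅y⁆⇒x≡y; ∣⁅x⁆∣≡1; x∈p∪q⁺; x∈p∪q⁻; q⊆p∪q; x∈p∩q⁺; x∈p∩q⁻; ⊆-trans; ⊆-antisym; p⊆q⇒∣p∣≤∣q∣; p⊂q⇒∣p∣<∣q∣; Empty-unique)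
open import Data.List using (List; []; _∷_; _++_; length; map; filter; concatMap; allFin; reverse; lookup; take)
import Data.List.Extrema.Nat as Extrema
open import Data.List.Membership.Propositional using (find; lose) renaming (_∈_ to _∈ˡ_; _∉_ to _∉ˡ_)
open import Data.List.Membership.Propositional.Properties using (∈-map⁺; ∈-map⁻; ∈-∃++; ∈-++⁻; ∈-++⁺ˡ; ∈-++⁺ʳ; ∈-filter⁺; ∈-filter⁻; ∈-allFin; ∈-concatMap⁺; ∈-lookup)
open import Data.List.Properties using (length-map; length-++; length-tabulate; length-filter; length-reverse; length-take; unfold-reverse; filter-notAll)
open import Data.List.Relation.Unary.All as All using ([]; _∷_)
open import Data.List.Relation.Unary.AllPairs as AllPairs using (AllPairs; []; _∷_)
import Data.List.Relation.Unary.AllPairs.Properties as AllPairsₚ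
open import Data.List.Relation.Unary.Any as Any using (here; there)
open import Data.List.Relation.Unary.Any.Properties using (reverse⁻)
open import Data.List.Relation.Unary.Unique.Propositional using (Unique)
import Data.List.Relation.Unary.Unique.Propositional.Properties as Uniqueₚ
open import Data.Nat using (ℕ; zero; suc; pred; _≤_; _<_; _^_; _*_; _+_; _∸_; _/_; _%_; z≤n; s≤s; s≤s⁻¹; NonZero; >-nonZero; >-nonZero⁻¹)
open import Data.Nat.DivMod using (m≡m%n+[m/n]*n)
open import Data.Nat.Properties
open import Data.Product using (_×_; Σ; ∃; _,_; proj₁; proj₂)
open import Data.Sum using (_⊎_; inj₁; inj₂)
open import Data.Vec.Base using ([]; _∷_; here; there)
import Data.Vec.Properties as Vecₚ
open import Function using (_∘_; id)
open import Relation.Binary.Definitions using (tri<; tri≈; tri>)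
open import Relation.Binary.PropositionalEquality using (_≡_; _≢_; refl; sym; trans; cong; cong₂; subst; module ≡-Reasoning)
open import Relation.Nullary using (¬_; Dec; yes; no; contradiction; ¬?)
open import Relation.Nullary.Decidable using (_×-dec_; _→-dec_; _⊎-dec_; decidable-stable; map′)

private
  variable
    A : Set
    n : ℕ

-- Lists and subsets

_∈ˡ?_ : (x : Fin n) (xs : List (Fin n)) → Dec (x ∈ˡ xs)
x ∈ˡ? xs = Any.any? (x Finₚ.≟_) xs

unique-⊆⇒length≤ : {xs ys : List A} → Unique xs → (∀ {x} → x ∈ˡ xs → x ∈ˡ ys) → length xs ≤ length ys
unique-⊆⇒length≤ [] _ = z≤n
unique-⊆⇒length≤ {xs = x ∷ xs} (x∉ ∷ u) sub with ∈-∃++ (sub (here refl))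
... | as , bs , refl = begin
  suc (length xs)           ≤⟨ s≤s (unique-⊆⇒length≤ u sub′) ⟩
  suc (length (as ++ bs))   ≡⟨ cong suc (length-++ as) ⟩
  suc (length as + length bs) ≡⟨ +-suc (length as) (length bs) ⟨
  length as + suc (length bs) ≡⟨ length-++ as ⟨
  length (as ++ x ∷ bs)     ∎
  where
  open ≤-Reasoning
  sub′ : ∀ {y} → y ∈ˡ xs → y ∈ˡ as ++ bs
  sub′ y∈xs with ∈-++⁻ as (sub (there y∈xs))
  ... | inj₁ y∈as          = ∈-++⁺ˡ y∈as
  ... | inj₂ (here refl)   = contradiction refl (All.lookup x∉ y∈xs)
  ... | inj₂ (there y∈bs)  = ∈-++⁺ʳ as y∈bs

unique⇒length≤n : {xs : List (Fin n)} → Unique xs → length xs ≤ n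
unique⇒length≤n {n} {xs} u =
  subst (length xs ≤_) (length-tabulate id) (unique-⊆⇒length≤ u λ _ → ∈-allFin _)

-- Pigeonhole. In the greedy constructions below, `ys` lists the forbidden vertices.
fresh : (f : A → Fin n) {xs : List A} (ys : List (Fin n)) → Unique (map f xs) → length ys < length xs →
        ∃ λ x → x ∈ˡ xs × f x ∉ˡ ys
fresh f {xs} ys u lt with Any.any? (λ x → ¬? (f x ∈ˡ? ys)) xs
... | yes some = let x , x∈ , x∉ = find some in x , x∈ , x∉
... | no none  = contradiction (unique-⊆⇒length≤ u all-in) (<⇒≱ (subst (length ys <_) (sym (length-map f xs)) lt))
  where
  all-in : ∀ {v} → v ∈ˡ map f xs → v ∈ˡ ys
  all-in v∈ with ∈-map⁻ f v∈
  ... | x , x∈ , refl with f x ∈ˡ? ys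
  ... | yes fx∈ = fx∈
  ... | no fx∉  = contradiction (lose x∈ fx∉) none

allPairs-lookup : {R : A → A → Set} {xs : List A} → AllPairs R xs → ∀ {x y} → x ∈ˡ xs → y ∈ˡ xs →
                  x ≡ y ⊎ R x y ⊎ R y x
allPairs-lookup (_ ∷ _)  (here refl) (here refl) = inj₁ refl
allPairs-lookup (r ∷ _)  (here refl) (there y∈)  = inj₂ (inj₁ (All.lookup r y∈))
allPairs-lookup (r ∷ _)  (there x∈)  (here refl) = inj₂ (inj₂ (All.lookup r x∈))
allPairs-lookup (_ ∷ rs) (there x∈)  (there y∈)  = allPairs-lookup rs x∈ y∈

length-concatMap≤ : {B : Set} (f : A → List B) (D : ℕ) → (∀ x → length (f x) ≤ D) →
                    ∀ xs → length (concatMap f xs) ≤ length xs * D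
length-concatMap≤ f D bound []       = z≤n
length-concatMap≤ f D bound (x ∷ xs) = subst (_≤ D + length xs * D) (sym (length-++ (f x)))
  (+-mono-≤ (bound x) (length-concatMap≤ f D bound xs))

all∈? : {P : Fin n → Set} → (∀ v → Dec (P v)) → (g : Subset n) → Dec (∀ {v} → v ∈ g → P v)
all∈? P? g = map′ (λ h {v} → h v) (λ h v → h) (Finₚ.all? λ v → (v ∈? g) →-dec P? v)

module _ {P Q : A → Set} (P? : ∀ x → Dec (P x)) (Q? : ∀ x → Dec (Q x)) where

  length-filter-mono : ∀ xs → (∀ {x} → x ∈ˡ xs → P x → Q x) →
                       length (filter P? xs) ≤ length (filter Q? xs)
  length-filter-mono [] _ = z≤n
  length-filter-mono (x ∷ xs) imp with P? x | Q? x
  ... | yes _  | yes _ = s≤s (length-filter-mono xs (imp ∘ there))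
  ... | yes px | no ¬q = contradiction (imp (here refl) px) ¬q
  ... | no _   | yes _ = m≤n⇒m≤1+n (length-filter-mono xs (imp ∘ there))
  ... | no _   | no _  = length-filter-mono xs (imp ∘ there)

  length-filter-filter : ∀ xs → length (filter P? (filter Q? xs)) ≤ length (filter P? xs)
  length-filter-filter [] = z≤n
  length-filter-filter (x ∷ xs) with Q? x
  length-filter-filter (x ∷ xs) | yes _ with P? x
  ... | yes _ = s≤s (length-filter-filter xs)
  ... | no _  = length-filter-filter xs
  length-filter-filter (x ∷ xs) | no _ with P? x
  ... | yes _ = m≤n⇒m≤1+n (length-filter-filter xs)
  ... | no _  = length-filter-filter xs

module _ {P : A → Set} (P? : ∀ x → Dec (P x)) where

  length-filter-split : ∀ xs → length xs ≡ length (filter P? xs) + length (filter (¬? ∘ P?) xs)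
  length-filter-split [] = refl
  length-filter-split (x ∷ xs) with P? x
  ... | yes _ = cong suc (length-filter-split xs)
  ... | no _  = trans (cong suc (length-filter-split xs)) (sym (+-suc _ _))

elems : Subset n → List (Fin n)
elems []          = []
elems (true ∷ p)  = zero ∷ map suc (elems p)
elems (false ∷ p) = map suc (elems p)

length-elems : (p : Subset n) → length (elems p) ≡ ∣ p ∣
length-elems []          = refl
length-elems (true ∷ p)  = cong suc (trans (length-map suc (elems p)) (length-elems p))
length-elems (false ∷ p) = trans (length-map suc (elems p)) (length-elems p)

∈-elems⁺ : {p : Subset n} {x : Fin n} → x ∈ p → x ∈ˡ elems p
∈-elems⁺ {p = true ∷ p}  here      = here refl
∈-elems⁺ {p = true ∷ p}  (there i) = there (∈-map⁺ suc (∈-elems⁺ i))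
∈-elems⁺ {p = false ∷ p} (there i) = ∈-map⁺ suc (∈-elems⁺ i)

∈-elems⁻ : (p : Subset n) {x : Fin n} → x ∈ˡ elems p → x ∈ p
∈-elems⁻ (true ∷ p) (here refl) = here
∈-elems⁻ (true ∷ p) (there i) with ∈-map⁻ suc i
... | _ , j , refl = there (∈-elems⁻ p j)
∈-elems⁻ (false ∷ p) i with ∈-map⁻ suc i
... | _ , j , refl = there (∈-elems⁻ p j)

elems-unique : (p : Subset n) → Unique (elems p)
elems-unique []          = []
elems-unique (true ∷ p)  = All.tabulate zero∉ ∷ Uniqueₚ.map⁺ Finₚ.suc-injective (elems-unique p)
  where
  zero∉ : ∀ {x} → x ∈ˡ map suc (elems p) → zero ≢ x
  zero∉ i refl with ∈-map⁻ suc i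
  ... | _ , _ , ()
elems-unique (false ∷ p) = Uniqueₚ.map⁺ Finₚ.suc-injective (elems-unique p)

fromList : List (Fin n) → Subset n
fromList []       = ⊥
fromList (x ∷ xs) = ⁅ x ⁆ ∪ fromList xs

∈-fromList⁺ : {xs : List (Fin n)} {x : Fin n} → x ∈ˡ xs → x ∈ fromList xs
∈-fromList⁺ (here refl) = x∈p∪q⁺ (inj₁ (x∈⁅x⁆ _))
∈-fromList⁺ (there i)   = x∈p∪q⁺ (inj₂ (∈-fromList⁺ i))

∈-fromList⁻ : (xs : List (Fin n)) {x : Fin n} → x ∈ fromList xs → x ∈ˡ xs
∈-fromList⁻ [] i = contradiction i ∉⊥
∈-fromList⁻ (y ∷ xs) i with x∈p∪q⁻ ⁅ y ⁆ (fromList xs) i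
... | inj₁ j = here (x∈⁅y⁆⇒x≡y y j)
... | inj₂ j = there (∈-fromList⁻ xs j)

∣fromList∣≤length : (xs : List (Fin n)) → ∣ fromList xs ∣ ≤ length xs
∣fromList∣≤length xs = subst (_≤ length xs) (length-elems (fromList xs))
  (unique-⊆⇒length≤ (elems-unique (fromList xs)) (∈-fromList⁻ xs ∘ ∈-elems⁻ (fromList xs)))

∣fromList∣≡length : {xs : List (Fin n)} → Unique xs → ∣ fromList xs ∣ ≡ length xs
∣fromList∣≡length {xs = xs} u = ≤-antisym (∣fromList∣≤length xs)
  (subst (length xs ≤_) (length-elems (fromList xs)) (unique-⊆⇒length≤ u (∈-elems⁺ ∘ ∈-fromList⁺)))

-- Independent sets in ordered graphs

module Pruning {X : Set} (Adj : X → X → Set) (adj? : ∀ x y → Dec (Adj x y))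
               (adj-refl : ∀ x → Adj x x) (κ : X → ℕ) (K : ℕ) where

  Up : X → X → Set
  Up x y = κ x ≤ κ y × Adj x y

  up? : ∀ x y → Dec (Up x y)
  up? x y = (κ x ≤? κ y) ×-dec adj? x y

  upDegree : List X → X → ℕ
  upDegree V x = length (filter (up? x) V)

  high? : ∀ V x → Dec (K < upDegree V x)
  high? V x = K <? upDegree V x

  high : List X → List X
  high V = filter (high? V) V

  -- Degrees are measured again in each round, so a vertex surviving `m` rounds has more than `K`
  -- up-neighbours that survived `m - 1`. This is what lets increasing paths with `m` edges start
  -- there.
  high^ : ℕ → List X → List X
  high^ zero    V = V
  high^ (suc m) V = high (high^ m V)

  -- `high^` unfolds at its last round, while the induction in `independent` removes the first one.
  high^-shift : ∀ m V → high^ m (high V) ≡ high (high^ m V)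
  high^-shift zero    V = refl
  high^-shift (suc m) V = cong high (high^-shift m V)

  high^-⊆ : ∀ m V {x} → x ∈ˡ high^ m V → x ∈ˡ V
  high^-⊆ zero    V i = i
  high^-⊆ (suc m) V i = high^-⊆ m V (proj₁ (∈-filter⁻ (high? (high^ m V)) i))

  high^-allPairs : ∀ {R : X → X → Set} m {V} → AllPairs R V → AllPairs R (high^ m V)
  high^-allPairs zero    rs = rs
  high^-allPairs (suc m) {V} rs = AllPairsₚ.filter⁺ (high? (high^ m V)) (high^-allPairs m rs)

  IndependentIn : List X → List X → Set
  IndependentIn V I = (∀ {x} → x ∈ˡ I → x ∈ˡ V) × AllPairs (λ x y → ¬ Adj x y) I

  -- Greedily take the κ-least vertex and discard its closed neighbourhood, all of which lies above it.
  greedy : ∀ m V → length V ≤ m → (∀ {x} → x ∈ˡ V → upDegree V x ≤ K) →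
           Σ (List X) λ I → IndependentIn V I × length V ≤ K * length I
  greedy m [] _ _ = [] , ((λ ()) , []) , z≤n
  greedy (suc m) V@(v ∷ vs) (s≤s len) low =
    x ∷ I , ((λ { (here refl) → x∈V ; (there i) → rest⊆ (I⊆ i) }) , (All.tabulate ¬adj-x ∷ ind)) , bound
    where
    x = Extrema.argmin κ v vs
    x∈V : x ∈ˡ V
    x∈V with Extrema.argmin-sel κ v vs
    ... | inj₁ eq = here eq
    ... | inj₂ i  = there i
    x-least : ∀ {y} → y ∈ˡ V → κ x ≤ κ y
    x-least (here refl) = Extrema.f[argmin]≤f[⊤] {f = κ} v vs
    x-least (there i)   = All.lookup (Extrema.f[argmin]≤f[xs] {f = κ} v vs) i
    rest = filter (¬? ∘ adj? x) V
    rest⊆ : ∀ {y} → y ∈ˡ rest → y ∈ˡ V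
    rest⊆ i = proj₁ (∈-filter⁻ (¬? ∘ adj? x) i)
    nbrs≥1 : 1 ≤ length (filter (adj? x) V)
    nbrs≥1 with filter (adj? x) V | ∈-filter⁺ (adj? x) x∈V (adj-refl x)
    ... | _ ∷ _ | _ = s≤s z≤n
    split : length V ≡ length (filter (adj? x) V) + length rest
    split = length-filter-split (adj? x) V
    rest-len : length rest ≤ m
    rest-len = ≤-trans (s≤s⁻¹ (≤-trans (+-monoˡ-≤ (length rest) nbrs≥1) (≤-reflexive (sym split)))) len

    rec = greedy m rest rest-len
      (λ {y} i → ≤-trans (length-filter-filter (up? y) (¬? ∘ adj? x) V) (low (rest⊆ i)))
    I = proj₁ rec
    I⊆ = proj₁ (proj₁ (proj₂ rec))
    ind = proj₂ (proj₁ (proj₂ rec))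
    ¬adj-x : ∀ {y} → y ∈ˡ I → ¬ Adj x y
    ¬adj-x i = proj₂ (∈-filter⁻ (¬? ∘ adj? x) {xs = V} (I⊆ i))
    bound : length V ≤ K * suc (length I)
    bound = begin
      length V                                     ≡⟨ split ⟩
      length (filter (adj? x) V) + length rest     ≤⟨ +-mono-≤
        (≤-trans (length-filter-mono (adj? x) (up? x) V (λ i adj → x-least i , adj)) (low x∈V))
        (proj₂ (proj₂ rec)) ⟩
      K + K * length I                             ≡⟨ *-suc K (length I) ⟨
      K * suc (length I)                           ∎
      where open ≤-Reasoning

  -- Split `V` into `high V`, which is empty after `m - 1` further rounds, and the rest, where
  -- `greedy` applies. The longer of the two independent lists pays for both halves, so every round
  -- adds a further `K` to the factor.
  independent : ∀ m V → high^ m V ≡ [] →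
                Σ (List X) λ I → IndependentIn V I × length V ≤ m * K * length I
  independent zero V refl = [] , ((λ ()) , []) , z≤n
  independent (suc m) V eq
    with greedy _ (filter (¬? ∘ high? V) V) ≤-refl
           (λ {x} i → ≤-trans (length-filter-filter (up? x) (¬? ∘ high? V) V)
                        (≮⇒≥ (proj₂ (∈-filter⁻ (¬? ∘ high? V) {xs = V} i))))
       | independent m (high V) (trans (high^-shift m V) eq)
  ... | I₁ , (I₁⊆ , ind₁) , len₁ | I₂ , (I₂⊆ , ind₂) , len₂ with ≤-total (length I₁) (length I₂)
  ... | inj₁ I₁≤I₂ = I₂ , ((λ i → proj₁ (∈-filter⁻ (high? V) (I₂⊆ i))) , ind₂) , (begin
      length V                                         ≡⟨ length-filter-split (high? V) V ⟩
      length (high V) + length (filter (¬? ∘ high? V) V) ≤⟨ +-mono-≤ len₂ (≤-trans len₁ (*-monoʳ-≤ K I₁≤I₂)) ⟩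
      m * K * length I₂ + K * length I₂                ≡⟨ *-distribʳ-+ (length I₂) (m * K) K ⟨
      (m * K + K) * length I₂                          ≡⟨ cong (_* length I₂) (+-comm (m * K) K) ⟩
      suc m * K * length I₂                            ∎)
      where open ≤-Reasoning
  ... | inj₂ I₂≤I₁ = I₁ , ((λ i → proj₁ (∈-filter⁻ (¬? ∘ high? V) (I₁⊆ i))) , ind₁) , (begin
      length V                                         ≡⟨ length-filter-split (high? V) V ⟩
      length (high V) + length (filter (¬? ∘ high? V) V) ≤⟨ +-mono-≤ (≤-trans len₂ (*-monoʳ-≤ (m * K) I₂≤I₁)) len₁ ⟩
      m * K * length I₁ + K * length I₁                ≡⟨ *-distribʳ-+ (length I₁) (m * K) K ⟨
      (m * K + K) * length I₁                          ≡⟨ cong (_* length I₁) (+-comm (m * K) K) ⟩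
      suc m * K * length I₁                            ∎)
      where open ≤-Reasoning

-- Loose paths and cycles

module LoosePaths {N : ℕ} (E : Subset N → Set) where

  -- An edge may meet all later edges only in its exit vertex `z`. As entry and exit vertices
  -- differ, `z` lies in the next edge but in none after it, so non-consecutive edges are disjoint.
  data Path : Fin N → Fin N → List (Subset N) → Set where
    edge : ∀ {x y A} → x ≢ y → E A → x ∈ A → y ∈ A → Path x y (A ∷ [])
    step : ∀ {x y z A es} → x ≢ z → E A → x ∈ A → z ∈ A →
           (∀ {B v} → B ∈ˡ es → v ∈ A → v ∈ B → v ≡ z) → Path z y es → Path x y (A ∷ es)

  start∈ : ∀ {x y A es} → Path x y (A ∷ es) → x ∈ A
  start∈ (edge _ _ x∈ _)     = x∈
  start∈ (step _ _ x∈ _ _ _) = x∈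

  end∈ : ∀ {x y es} → Path x y es → ∃ λ B → B ∈ˡ es × y ∈ B
  end∈ (edge _ _ _ y∈)       = _ , here refl , y∈
  end∈ (step _ _ _ _ _ path) with end∈ path
  ... | B , B∈ , y∈B = B , there B∈ , y∈B

  start≢end : ∀ {x y es} → Path x y es → x ≢ y
  start≢end (edge x≢y _ _ _) = x≢y
  start≢end (step x≢z _ x∈ _ meet path) refl with end∈ path
  ... | B , B∈ , x∈B = x≢z (meet B∈ x∈ x∈B)

  concat : ∀ {x y z es fs} → Path x y es → Path y z fs →
           (∀ {A B v} → A ∈ˡ es → B ∈ˡ fs → v ∈ A → v ∈ B → v ≡ y) → Path x z (es ++ fs)
  concat (edge x≢y EA x∈ y∈) q meet = step x≢y EA x∈ y∈ (meet (here refl)) q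
  concat {y = y} {es = A ∷ es} {fs} (step {z = w} x≢w EA x∈ w∈ meetA path) q meet =
    step x≢w EA x∈ w∈ meet′ (concat path q (meet ∘ there))
    where
    meet′ : ∀ {B v} → B ∈ˡ es ++ fs → v ∈ A → v ∈ B → v ≡ w
    meet′ B∈ v∈A v∈B with ∈-++⁻ es B∈
    ... | inj₁ B∈es = meetA B∈es v∈A v∈B
    ... | inj₂ B∈fs with meet (here refl) B∈fs v∈A v∈B | end∈ path
    -- Here `v` is `y`, which also lies in the last edge of `path`, so `meetA` identifies it with
    -- `w`.
    ... | refl | C , C∈ , y∈C = meetA C∈ v∈A y∈C

  path-reverse : ∀ {x y es} → Path x y es → Path y x (reverse es)
  path-reverse (edge x≢y EA x∈ y∈) = edge (x≢y ∘ sym) EA y∈ x∈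
  path-reverse {x} {y} {A ∷ es} (step x≢z EA x∈ z∈ meet path) =
    subst (Path y x) (sym (unfold-reverse A es))
      (concat (path-reverse path) (edge (x≢z ∘ sym) EA z∈ x∈) λ { B∈ (here refl) v∈B v∈A → meet (reverse⁻ B∈) v∈A v∈B })

  start∈lookup⇒0 : ∀ {x y es} → Path x y es → ∀ j → x ∈ lookup es j → toℕ j ≡ 0
  start∈lookup⇒0 (edge _ _ _ _) zero _ = refl
  start∈lookup⇒0 (step _ _ _ _ _ _) zero _ = refl
  start∈lookup⇒0 (step x≢z _ x∈ _ meet _) (suc j) x∈B = contradiction (meet (∈-lookup j) x∈ x∈B) x≢z

  start∈first : ∀ {x y es} → Path x y es → ∀ j → toℕ j ≡ 0 → x ∈ lookup es j
  start∈first (edge _ _ x∈ _)       zero _ = x∈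
  start∈first (step _ _ x∈ _ _ _)   zero _ = x∈

  end∈lookup⇒last : ∀ {x y es} → Path x y es → ∀ j → y ∈ lookup es j → suc (toℕ j) ≡ length es
  end∈lookup⇒last (edge _ _ _ _) zero _ = refl
  end∈lookup⇒last (step _ _ _ _ meet path) zero y∈A with end∈ path
  ... | B , B∈ , y∈B = contradiction (sym (meet B∈ y∈A y∈B)) (start≢end path)
  end∈lookup⇒last (step _ _ _ _ _ path) (suc j) y∈ = cong suc (end∈lookup⇒last path j y∈)

  end∈last : ∀ {x y es} → Path x y es → ∀ j → suc (toℕ j) ≡ length es → y ∈ lookup es j
  end∈last (edge _ _ _ y∈) zero _ = y∈
  end∈last {es = _ ∷ es} (step _ _ _ _ _ path) zero eq with es | path
  ... | [] | ()
  end∈last (step _ _ _ _ _ path) (suc j) eq = end∈last path j (cong pred eq)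

  meet⇒consecutive : ∀ {x y es v} → Path x y es → ∀ i j → toℕ i < toℕ j →
                     v ∈ lookup es i → v ∈ lookup es j → toℕ j ≡ suc (toℕ i)
  meet⇒consecutive (edge _ _ _ _) zero zero () _ _
  meet⇒consecutive (step _ _ _ _ meet path) zero (suc j) _ v∈ v∈′ with meet (∈-lookup j) v∈ v∈′
  ... | refl = cong suc (start∈lookup⇒0 path j v∈′)
  meet⇒consecutive (step _ _ _ _ _ path) (suc i) (suc j) (s≤s i<j) v∈ v∈′ =
    cong suc (meet⇒consecutive path i j i<j v∈ v∈′)

  MeetOnce : Subset N → Subset N → Set
  MeetOnce A B = ∃ λ w → w ∈ A × w ∈ B × (∀ {v} → v ∈ A → v ∈ B → v ≡ w)

  Apart : Subset N → Subset N → Set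
  Apart A B = ∀ {v} → v ∈ A → ¬ v ∈ B

  consecutive⇒meet : ∀ {x y es} → Path x y es → ∀ i j → toℕ j ≡ suc (toℕ i) →
                     MeetOnce (lookup es i) (lookup es j)
  consecutive⇒meet (edge _ _ _ _) zero zero ()
  consecutive⇒meet (step {z = z} _ _ _ z∈ meet path) zero (suc j) eq =
    z , z∈ , start∈first path j (cong pred eq) , meet (∈-lookup j)
  consecutive⇒meet (step _ _ _ _ _ path) (suc i) (suc j) eq =
    consecutive⇒meet path i j (cong pred eq)

  path-edges : ∀ {x y es} → Path x y es → ∀ {A} → A ∈ˡ es → E A
  path-edges (edge _ EA _ _)       (here refl) = EA
  path-edges (step _ EA _ _ _ _)   (here refl) = EA
  path-edges (step _ _ _ _ _ path) (there i)   = path-edges path i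

  -- One distinguished edge `A` closed by a path; the index counts edges. Two edges sharing two
  -- vertices form a `Cycle 2`, so agreement with loose cycles is claimed from length 3 on.
  data Cycle : ℕ → Set where
    cycle : ∀ {x y A es} → x ≢ y → E A → x ∈ A → y ∈ A → Path y x es →
            (∀ {B v} → B ∈ˡ es → v ∈ A → v ∈ B → v ≡ x ⊎ v ≡ y) → Cycle (suc (length es))

  -- All edges of the first path but its first are moved to the front of the second path, leaving
  -- one edge to be closed.
  close : ∀ {x y es fs} → Path x y es → Path y x fs →
          (∀ {A B v} → A ∈ˡ es → B ∈ˡ fs → v ∈ A → v ∈ B → v ≡ x ⊎ v ≡ y) →
          Cycle (length es + length fs)
  close (edge x≢y EA x∈ y∈) q meet = cycle x≢y EA x∈ y∈ q (meet (here refl))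
  close {x} {y} {A ∷ es} {fs} (step {z = z} x≢z EA x∈ z∈ meetA path) q meet =
    subst (Cycle ∘ suc) (length-++ es)
      (cycle x≢z EA x∈ z∈ (concat path q meet₁) meet₂)
    where
    meet₁ : ∀ {B C v} → B ∈ˡ es → C ∈ˡ fs → v ∈ B → v ∈ C → v ≡ y
    meet₁ B∈ C∈ v∈B v∈C with meet (there B∈) C∈ v∈B v∈C
    ... | inj₁ refl = contradiction (meetA B∈ x∈ v∈B) x≢z
    ... | inj₂ eq   = eq
    meet₂ : ∀ {B v} → B ∈ˡ es ++ fs → v ∈ A → v ∈ B → v ≡ x ⊎ v ≡ z
    meet₂ B∈ v∈A v∈B with ∈-++⁻ es B∈
    ... | inj₁ B∈es = inj₂ (meetA B∈es v∈A v∈B)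
    ... | inj₂ B∈fs with meet (here refl) B∈fs v∈A v∈B | end∈ path
    ... | inj₁ eq   | _ = inj₁ eq
    ... | inj₂ refl | C , C∈ , y∈C = inj₂ (meetA C∈ v∈A y∈C)

  module _ {x y A es} (2≤∣es∣ : 2 ≤ length es) (x∈A : x ∈ A) (y∈A : y ∈ A) (path : Path y x es)
           (meet : ∀ {B v} → B ∈ˡ es → v ∈ A → v ∈ B → v ≡ x ⊎ v ≡ y) where

    private
      l : ℕ
      l = suc (length es)
      e = lookup (A ∷ es)

      -- The use of length at least 3: the neighbours of `A` on its two sides are different edges,
      -- so each shares only one vertex with `A`.
      not-both-ends : (j : Fin (length es)) → toℕ j ≡ 0 → suc (toℕ j) ≢ length es
      not-both-ends j j≡0 eq = <-irrefl (trans (cong suc (sym j≡0)) eq) 2≤∣es∣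

    ordered-intersections : (i j : Fin l) → toℕ i < toℕ j →
      (CycAdj l i j → MeetOnce (e i) (e j)) × (¬ CycAdj l i j → Apart (e i) (e j))
    ordered-intersections zero (suc j) _ = adjacent , apart
      where
      adjacent : CycAdj l zero (suc j) → MeetOnce A (lookup es j)
      adjacent (inj₁ 1+j≡1) = y , y∈A , start∈first path j j≡0 , only-y
        where
        j≡0 = cong pred 1+j≡1
        only-y : ∀ {v} → v ∈ A → v ∈ lookup es j → v ≡ y
        only-y v∈A v∈B with meet (∈-lookup j) v∈A v∈B
        ... | inj₁ refl = contradiction (end∈lookup⇒last path j v∈B) (not-both-ends j j≡0)
        ... | inj₂ eq   = eq
      adjacent (inj₂ (inj₂ (inj₂ (_ , eq)))) = x , x∈A , end∈last path j last , only-x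
        where
        last = cong pred eq
        only-x : ∀ {v} → v ∈ A → v ∈ lookup es j → v ≡ x
        only-x v∈A v∈B with meet (∈-lookup j) v∈A v∈B
        ... | inj₁ eq′  = eq′
        ... | inj₂ refl = contradiction last (not-both-ends j (start∈lookup⇒0 path j v∈B))
      apart : ¬ CycAdj l zero (suc j) → Apart A (lookup es j)
      apart ¬adj v∈A v∈B with meet (∈-lookup j) v∈A v∈B
      ... | inj₁ refl = ¬adj (inj₂ (inj₂ (inj₂ (refl , cong suc (end∈lookup⇒last path j v∈B)))))
      ... | inj₂ refl = ¬adj (inj₁ (cong suc (start∈lookup⇒0 path j v∈B)))
    ordered-intersections (suc i) (suc j) (s≤s i<j) = adjacent , apart
      where
      adjacent : CycAdj l (suc i) (suc j) → MeetOnce (lookup es i) (lookup es j)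
      adjacent (inj₁ eq)                     = consecutive⇒meet path i j (cong pred eq)
      adjacent (inj₂ (inj₁ eq))              = contradiction (subst (_≤ toℕ j) (cong pred eq) (≤-trans (n≤1+n _) i<j)) 1+n≰n
      adjacent (inj₂ (inj₂ (inj₁ (() , _))))
      adjacent (inj₂ (inj₂ (inj₂ (() , _))))
      apart : ¬ CycAdj l (suc i) (suc j) → Apart (lookup es i) (lookup es j)
      apart ¬adj v∈ v∈′ = ¬adj (inj₁ (cong suc (meet⇒consecutive path i j i<j v∈ v∈′)))

  CycAdj-sym : ∀ {l} {i j : Fin l} → CycAdj l i j → CycAdj l j i
  CycAdj-sym (inj₁ eq)               = inj₂ (inj₁ eq)
  CycAdj-sym (inj₂ (inj₁ eq))        = inj₁ eq
  CycAdj-sym (inj₂ (inj₂ (inj₁ eq))) = inj₂ (inj₂ (inj₂ eq))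
  CycAdj-sym (inj₂ (inj₂ (inj₂ eq))) = inj₂ (inj₂ (inj₁ eq))

  MeetOnce⇒∣∩∣≡1 : ∀ {A B} → MeetOnce A B → ∣ A ∩ B ∣ ≡ 1
  MeetOnce⇒∣∩∣≡1 {A} {B} (w , w∈A , w∈B , only) = trans (cong ∣_∣ (⊆-antisym ⊆w w⊆)) (∣⁅x⁆∣≡1 w)
    where
    ⊆w : A ∩ B ⊆ ⁅ w ⁆
    ⊆w v∈ with x∈p∩q⁻ A B v∈
    ... | v∈A , v∈B with only v∈A v∈B
    ... | refl = x∈⁅x⁆ w
    w⊆ : ⁅ w ⁆ ⊆ A ∩ B
    w⊆ v∈ with x∈⁅y⁆⇒x≡y w v∈
    ... | refl = x∈p∩q⁺ (w∈A , w∈B)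

  Apart⇒∩≡⊥ : ∀ {A B} → Apart A B → A ∩ B ≡ ⊥
  Apart⇒∩≡⊥ {A} {B} apart = Empty-unique λ (v , v∈) → let v∈A , v∈B = x∈p∩q⁻ A B v∈ in apart v∈A v∈B

  CyclicIntersections : ∀ l → (Fin l → Subset N) → Set
  CyclicIntersections l e = ∀ i j → i ≢ j →
    (CycAdj l i j → ∣ e i ∩ e j ∣ ≡ 1) × (¬ CycAdj l i j → e i ∩ e j ≡ ⊥)

  cycle⇒edges : ∀ {l} → 3 ≤ l → Cycle l →
                Σ (Fin l → Subset N) λ e → (∀ i → E (e i)) × CyclicIntersections l e
  cycle⇒edges (s≤s 2≤∣es∣) (cycle {A = A} {es} x≢y EA x∈A y∈A path meet) = e , E-e , cyclic
    where
    l : ℕ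
    l = suc (length es)
    e = lookup (A ∷ es)
    E-e : ∀ i → E (e i)
    E-e zero    = EA
    E-e (suc i) = path-edges path (∈-lookup i)
    ordered = ordered-intersections 2≤∣es∣ x∈A y∈A path meet
    cyclic : CyclicIntersections l e
    cyclic i j i≢j with <-cmp (toℕ i) (toℕ j)
    ... | tri< i<j _ _ = MeetOnce⇒∣∩∣≡1 ∘ proj₁ (ordered i j i<j) , λ ¬adj → Apart⇒∩≡⊥ (proj₂ (ordered i j i<j) ¬adj)
    ... | tri≈ _ eq _  = contradiction (Finₚ.toℕ-injective eq) i≢j
    ... | tri> _ _ j<i =
        (λ adj → let w , w∈ , w∈′ , only = proj₁ (ordered j i j<i) (CycAdj-sym {j = j} adj)
                 in MeetOnce⇒∣∩∣≡1 (w , w∈′ , w∈ , λ v∈ v∈′ → only v∈′ v∈))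
      , (λ ¬adj → Apart⇒∩≡⊥ (λ v∈ v∈′ → proj₂ (ordered j i j<i) (¬adj ∘ CycAdj-sym {j = i}) v∈′ v∈))

-- Jumps of monotone sequences

consecutive-jump : (β : ℕ → ℕ) (L : ℕ) → β 0 < β L → ∃ λ i → i < L × β i < β (suc i)
consecutive-jump β zero    lt = contradiction lt (<-irrefl refl)
consecutive-jump β (suc L) lt with β L <? β (suc L)
... | yes jump = L , ≤-refl , jump
... | no ¬jump with consecutive-jump β L (<-≤-trans lt (≮⇒≥ ¬jump))
... | i , i<L , jump = i , m≤n⇒m≤1+n i<L , jump

module _ (β : ℕ → ℕ) (L : ℕ) (step : ∀ {m} → m < L → β m ≤ β (suc m)) where

  monotone : ∀ {a b} → a ≤ b → b ≤ L → β a ≤ β b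
  monotone {a} {zero} z≤n _ = ≤-refl
  monotone {a} {suc b} a≤1+b 1+b≤L with m≤n⇒m<n∨m≡n a≤1+b
  ... | inj₁ (s≤s a≤b) = ≤-trans (monotone a≤b (<⇒≤ 1+b≤L)) (step 1+b≤L)
  ... | inj₂ refl      = ≤-refl

  -- A window of length `d` starting at a consecutive jump contains it. If that window would pass
  -- `L`, the one ending at `L` starts no later than the jump and contains it too.
  window-jump : β 0 < β L → ∀ {d} → 1 ≤ d → d ≤ L → ∃ λ a → a + d ≤ L × β a < β (a + d)
  window-jump lt {d} 1≤d d≤L with consecutive-jump β L lt
  ... | i , i<L , jump with i + d ≤? L
  ... | yes i+d≤L = i , i+d≤L , <-≤-trans jump (monotone 1+i≤i+d i+d≤L)
    where
    1+i≤i+d : suc i ≤ i + d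
    1+i≤i+d = subst (_≤ i + d) (+-comm i 1) (+-monoʳ-≤ i 1≤d)
  ... | no i+d≰L = L ∸ d , ≤-reflexive eq ,
          <-≤-trans (≤-<-trans (monotone L∸d≤i (<⇒≤ i<L)) jump) (subst (λ m → β (suc i) ≤ β m) (sym eq) (monotone i<L ≤-refl))
    where
    eq : L ∸ d + d ≡ L
    eq = m∸n+n≡m d≤L
    L∸d≤i : L ∸ d ≤ i
    L∸d≤i = m≤n+o⇒m∸n≤o L d (subst (L ≤_) (+-comm i d) (<⇒≤ (≰⇒> i+d≰L)))

-- Trees of loose paths

-- A node carries its whole ancestry: its vertex, the edge linking it to its parent, and the parent.
-- A layer of a tree is then a plain list of nodes.
data Node (N : ℕ) : Set where
  root : Fin N → Node N
  node : Fin N → Subset N → Node N → Node N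

module _ {N : ℕ} where

  vert : Node N → Fin N
  vert (root v)     = v
  vert (node v _ _) = v

  link : Node N → Subset N
  -- The empty default excludes roots from later layers, whose nodes lie in their own links.
  link (root _)     = ⊥
  link (node _ g _) = g

  parent : Node N → Node N
  parent (root v)     = root v
  parent (node _ _ x) = x

  anc : ℕ → Node N → Node N
  anc zero    x = x
  anc (suc s) x = anc s (parent x)

  chain : ℕ → Node N → List (Subset N)
  chain zero    x = []
  chain (suc s) x = link x ∷ chain s (parent x)

  length-chain : ∀ s x → length (chain s x) ≡ s
  length-chain zero    x = refl
  length-chain (suc s) x = cong suc (length-chain s (parent x))

  -- The base-N number spelled by the path from the root: nodes of one level are compared lexicographically.
  key : Node N → ℕ
  key (root _)     = 0
  key (node v _ x) = key x * N + toℕ v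

  -- The last digit is below `N`, so it cannot make up for a smaller parent key.
  key-parent-mono : ∀ x y → key x ≤ key y → key (parent x) ≤ key (parent y)
  key-parent-mono (root _) _ _ = z≤n
  key-parent-mono (node v _ x) (root w) le = *-cancelʳ-≤ (key x) 0 N ⦃ Finₚ.nonZeroIndex v ⦄ (≤-trans (m≤m+n (key x * N) (toℕ v)) le)
  key-parent-mono (node v _ x) (node w _ y) le = ≮⇒≥ λ ky<kx → <⇒≱ (begin-strict
      key y * N + toℕ w ≡⟨ +-comm (key y * N) (toℕ w) ⟩
      toℕ w + key y * N <⟨ +-monoˡ-< (key y * N) (Finₚ.toℕ<n w) ⟩
      suc (key y) * N   ≤⟨ *-monoˡ-≤ N ky<kx ⟩
      key x * N         ≤⟨ m≤m+n (key x * N) (toℕ v) ⟩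
      key x * N + toℕ v ∎) le
    where open ≤-Reasoning

  key-anc-mono : ∀ s x y → key x ≤ key y → key (anc s x) ≤ key (anc s y)
  key-anc-mono zero    x y le = le
  key-anc-mono (suc s) x y le = key-anc-mono s (parent x) (parent y) (key-parent-mono x y le)

module Trees {N : ℕ} (E : Subset N → Set) (r : ℕ) (U : List (Fin N)) where

  open LoosePaths E

  -- `B` and `B′` list the vertices covered by the tree before and after the new layer. Of the new
  -- vertices in a link only `vert x` becomes a leaf; the others are merely covered.
  record Child (S : List (Node N)) (B B′ : List (Fin N)) (x : Node N) : Set where
    field
      parent∈    : parent x ∈ˡ S
      link-edge  : E (link x)
      link-in    : ∀ {v} → v ∈ link x → v ∈ˡ U
      parent∈link : vert (parent x) ∈ link x
      link∩B     : ∀ {v} → v ∈ link x → v ∈ˡ B → v ≡ vert (parent x)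
      vert∈link  : vert x ∈ link x
      vert∉B     : vert x ∉ˡ B
      link⊆B′    : ∀ {v} → v ∈ link x → v ∈ˡ B′

  record Layer (S : List (Node N)) (B : List (Fin N)) (S′ : List (Node N)) (B′ : List (Fin N)) : Set where
    field
      child   : ∀ {x} → x ∈ˡ S′ → Child S B B′ x
      B⊆B′    : ∀ {v} → v ∈ˡ B → v ∈ˡ B′
      petals  : ∀ {x y v} → x ∈ˡ S′ → y ∈ˡ S′ → v ∈ link x → v ∈ link y → v ∉ˡ B → x ≡ y
      unique  : Unique (map vert S′)
      size    : length B′ ≤ length B + length S′ * r

    module _ {x : Node N} (x∈ : x ∈ˡ S′) where
      open Child (child x∈) public

  data Tree : ℕ → List (Node N) → List (Fin N) → Set where
    seed : ∀ {v} → v ∈ˡ U → Tree 0 (root v ∷ []) (v ∷ [])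
    grow : ∀ {j S B S′ B′} → Tree j S B → Layer S B S′ B′ → Tree (suc j) S′ B′

  vert∈U : ∀ {j S B x} → Tree j S B → x ∈ˡ S → vert x ∈ˡ U
  vert∈U (seed v∈U) (here refl) = v∈U
  vert∈U (grow _ layer) x∈ = link-in x∈ (vert∈link x∈)
    where open Layer layer

  vert∈B : ∀ {j S B x} → Tree j S B → x ∈ˡ S → vert x ∈ˡ B
  vert∈B (seed _) (here refl) = here refl
  vert∈B (grow _ layer) x∈ = link⊆B′ x∈ (vert∈link x∈)
    where open Layer layer

  vert-injective : ∀ {j S B x y} → Tree j S B → x ∈ˡ S → y ∈ˡ S → vert x ≡ vert y → x ≡ y
  vert-injective (seed _) (here refl) (here refl) _ = refl
  vert-injective (grow _ layer) x∈ y∈ eq =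
    petals x∈ y∈ (vert∈link x∈) (subst (_∈ _) (sym eq) (vert∈link y∈)) (vert∉B x∈)
    where open Layer layer

  vert-unique : ∀ {j S B} → Tree j S B → Unique (map vert S)
  vert-unique (seed _)       = [] ∷ []
  vert-unique (grow _ layer) = Layer.unique layer

  -- Applying `key-parent-mono` both ways equates the parent keys. Cancelling them leaves equal last
  -- digits, and the vertex determines the node.
  key-injective : ∀ {j S B x y} → Tree j S B → x ∈ˡ S → y ∈ˡ S → key x ≡ key y → x ≡ y
  key-injective (seed _) (here refl) (here refl) _ = refl
  key-injective {x = root _} (grow _ layer) x∈ y∈ _ = contradiction (Layer.vert∈link layer x∈) ∉⊥
  key-injective {y = root _} (grow _ layer) x∈ y∈ _ = contradiction (Layer.vert∈link layer y∈) ∉⊥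
  key-injective {x = node v g x} {node w h y} tree@(grow _ layer) x∈ y∈ eq =
    vert-injective tree x∈ y∈ (Finₚ.toℕ-injective (+-cancelˡ-≡ (key x * N) _ _ (trans eq (cong (λ k → k * N + toℕ w) (sym parents)))))
    where
    parents : key x ≡ key y
    parents = ≤-antisym (key-parent-mono (node v g x) (node w h y) (≤-reflexive eq))
                        (key-parent-mono (node w h y) (node v g x) (≤-reflexive (sym eq)))

  key-anc-injective : ∀ {j S B x y} s → s ≤ j → Tree j S B → x ∈ˡ S → y ∈ˡ S →
                      key (anc s x) ≡ key (anc s y) → anc s x ≡ anc s y
  key-anc-injective zero _ tree x∈ y∈ eq = key-injective tree x∈ y∈ eq
  key-anc-injective (suc s) (s≤s s≤j) (grow tree layer) x∈ y∈ eq =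
    key-anc-injective s s≤j tree (parent∈ x∈) (parent∈ y∈) eq
    where open Layer layer

  chain⊆B : ∀ {j S B x A v} s → s ≤ j → Tree j S B → x ∈ˡ S → A ∈ˡ chain s x → v ∈ A → v ∈ˡ B
  chain⊆B (suc s) (s≤s s≤j) (grow tree layer) x∈ (here refl) v∈ = Layer.link⊆B′ layer x∈ v∈
  chain⊆B (suc s) (s≤s s≤j) (grow tree layer) x∈ (there A∈) v∈ =
    Layer.B⊆B′ layer (chain⊆B s s≤j tree (Layer.parent∈ layer x∈) A∈ v∈)

  -- Looseness comes from `link∩B`: the links further up lie in `B`, which the first link meets only
  -- in the parent's vertex.
  climb : ∀ {j S B x} s → suc s ≤ j → Tree j S B → x ∈ˡ S →
          Path (vert x) (vert (anc (suc s) x)) (chain (suc s) x)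
  climb {x = x} s (s≤s s≤j) (grow tree layer) x∈ = go s s≤j
    where
    open Layer layer
    x≢parent : vert x ≢ vert (parent x)
    x≢parent eq = vert∉B x∈ (subst (_∈ˡ _) (sym eq) (vert∈B tree (parent∈ x∈)))
    go : ∀ s → s ≤ _ → Path (vert x) (vert (anc (suc s) x)) (chain (suc s) x)
    go zero    _   = edge x≢parent (link-edge x∈) (vert∈link x∈) (parent∈link x∈)
    go (suc s) s<j = step x≢parent (link-edge x∈) (vert∈link x∈) (parent∈link x∈)
      (λ B∈ v∈ v∈B → link∩B x∈ v∈ (chain⊆B (suc s) s<j tree (parent∈ x∈) B∈ v∈B))
      (climb s s<j tree (parent∈ x∈))

  -- At the branching point the two links are different petals, so they share only the parent's
  -- vertex. Below it, two lowest links cannot meet at all: inside `B` a common vertex would equate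
  -- the parents, outside `B` the nodes. If a lowest link meets the rest of the other chain, it does
  -- so in its parent's vertex, and the induction hypothesis for the parents applies.
  chains-meet : ∀ {j S B x y A C v} s → suc s ≤ j → Tree j S B → x ∈ˡ S → y ∈ˡ S →
                anc (suc s) x ≡ anc (suc s) y → anc s x ≢ anc s y →
                A ∈ˡ chain (suc s) x → C ∈ˡ chain (suc s) y → v ∈ A → v ∈ C → v ≡ vert (anc (suc s) x)
  chains-meet {v = v} zero _ (grow {B = B} tree layer) x∈ y∈ eq x≢y (here refl) (here refl) v∈ v∈′ with v ∈ˡ? B
  ... | yes v∈B = Layer.link∩B layer x∈ v∈ v∈B
  ... | no v∉B  = contradiction (Layer.petals layer x∈ y∈ v∈ v∈′ v∉B) x≢y
  chains-meet {x = x} {y} {v = v} (suc s) (s≤s s<j) (grow {B = B} tree layer) x∈ y∈ eq x≢y = go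
    where
    open Layer layer
    px = parent∈ x∈
    py = parent∈ y∈
    go : ∀ {A C} → A ∈ˡ chain (suc (suc s)) x → C ∈ˡ chain (suc (suc s)) y → v ∈ A → v ∈ C →
         v ≡ vert (anc (suc (suc s)) x)
    go (here refl) (here refl) v∈ v∈′ with v ∈ˡ? B
    ... | yes v∈B = contradiction
            (cong (anc s) (vert-injective tree px py (trans (sym (link∩B x∈ v∈ v∈B)) (link∩B y∈ v∈′ v∈B)))) x≢y
    ... | no v∉B  = contradiction (cong (anc (suc s)) (petals x∈ y∈ v∈ v∈′ v∉B)) x≢y
    go (here refl) (there C∈) v∈ v∈′ with link∩B x∈ v∈ (chain⊆B (suc s) s<j tree py C∈ v∈′)
    ... | refl = chains-meet s s<j tree px py eq x≢y (here refl) C∈ (start∈ (climb s s<j tree px)) v∈′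
    go (there A∈) (here refl) v∈ v∈′ with link∩B y∈ v∈′ (chain⊆B (suc s) s<j tree px A∈ v∈)
    ... | refl = chains-meet s s<j tree px py eq x≢y A∈ (here refl) v∈ (start∈ (climb s s<j tree py))
    go (there A∈) (there C∈) v∈ v∈′ = chains-meet s s<j tree px py eq x≢y A∈ C∈ v∈ v∈′

  -- A leaf lies outside the older tree, so only the lowest link can contain it, and links of
  -- different leaves share no vertex there.
  leaf-in-chain : ∀ {j S B x y A} s → s ≤ j → Tree j S B → x ∈ˡ S → y ∈ˡ S →
                  A ∈ˡ chain s x → vert y ∈ A → vert y ≡ vert x
  leaf-in-chain (suc s) _ (grow tree layer) x∈ y∈ (here refl) v∈ =
    cong vert (petals y∈ x∈ (vert∈link y∈) v∈ (vert∉B y∈))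
    where open Layer layer
  leaf-in-chain (suc s) (s≤s s≤j) (grow tree layer) x∈ y∈ (there A∈) v∈ =
    contradiction (chain⊆B s s≤j tree (Layer.parent∈ layer x∈) A∈ v∈) (Layer.vert∉B layer y∈)

  -- The sequences are total on `ℕ` and constrained only up to `L`, so that segments can be cut out
  -- at any offset. By `gs∩B` the edges touch the tree only in leaves.
  record IncreasingPath (S : List (Node N)) (B : List (Fin N)) (L : ℕ) : Set where
    field
      xs     : ℕ → Node N
      gs     : ℕ → Subset N
      xs∈    : ∀ {m} → m ≤ L → xs m ∈ˡ S
      key≤   : ∀ {m} → m < L → key (xs m) ≤ key (xs (suc m))
      gs-edge : ∀ {m} → m < L → E (gs m)
      left∈  : ∀ {m} → m < L → vert (xs m) ∈ gs m
      right∈ : ∀ {m} → m < L → vert (xs (suc m)) ∈ gs m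
      vert≢  : ∀ {m} → m < L → vert (xs m) ≢ vert (xs (suc m))
      gs∩B   : ∀ {m v} → m < L → v ∈ gs m → v ∈ˡ B → v ∈ˡ map vert S
      meet   : ∀ {m m′ v} → m < m′ → m′ < L → v ∈ gs m → v ∈ gs m′ → v ≡ vert (xs (suc m))

    segment : ℕ → ℕ → List (Subset N)
    segment a zero    = []
    segment a (suc d) = gs a ∷ segment (suc a) d

    length-segment : ∀ a d → length (segment a d) ≡ d
    length-segment a zero    = refl
    length-segment a (suc d) = cong suc (length-segment (suc a) d)

    ∈-segment : ∀ {A} a d → A ∈ˡ segment a d → ∃ λ m → a ≤ m × m < a + d × A ≡ gs m
    ∈-segment a (suc d) (here refl) = a , ≤-refl , m<m+n a (s≤s z≤n) , refl
    ∈-segment a (suc d) (there A∈) with ∈-segment (suc a) d A∈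
    ... | m , a<m , m< , eq = m , <⇒≤ a<m , subst (m <_) (sym (+-suc a d)) m< , eq

    segment-path : ∀ a d → a + suc d ≤ L → Path (vert (xs a)) (vert (xs (a + suc d))) (segment a (suc d))
    segment-path a zero le rewrite +-comm a 1 = edge (vert≢ le) (gs-edge le) (left∈ le) (right∈ le)
    segment-path a (suc d) le rewrite +-suc a (suc d) =
      step (vert≢ a<L) (gs-edge a<L) (left∈ a<L) (right∈ a<L) meet′ (segment-path (suc a) d le)
      where
      a<L : a < L
      a<L = ≤-trans (s≤s (m≤m+n a (suc d))) le
      meet′ : ∀ {B v} → B ∈ˡ segment (suc a) (suc d) → v ∈ gs a → v ∈ B → v ≡ vert (xs (suc a))
      meet′ B∈ v∈ v∈B with ∈-segment (suc a) (suc d) B∈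
      ... | m , a<m , m< , refl = meet a<m (≤-trans m< le) v∈ v∈B

  -- Passing to parents keeps the keys weakly ordered, and at the root they agree; `s` is the last
  -- height at which they still differ.
  branching : ∀ {j S B} → Tree j S B → ∀ {x y} → x ∈ˡ S → y ∈ˡ S → key x < key y →
              ∃ λ s → suc s ≤ j × key (anc (suc s) x) ≡ key (anc (suc s) y) × key (anc s x) < key (anc s y)
  branching (seed _) (here refl) (here refl) lt = contradiction lt (<-irrefl refl)
  branching (grow tree layer) {x} {y} x∈ y∈ lt
    with m≤n⇒m<n∨m≡n (key-parent-mono x y (<⇒≤ lt))
  ... | inj₂ eq = 0 , s≤s z≤n , eq , lt
  ... | inj₁ lt′ with branching tree (Layer.parent∈ layer x∈) (Layer.parent∈ layer y∈) lt′
  ... | s , s<j , eq , lt″ = suc s , s≤s s<j , eq , lt″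

  -- If the first and the last leaf branch at height s + 1, then so do two leaves at distance
  -- L − 2s along the path, which closes up to a cycle of length (L − 2s) + 2(s + 1).
  increasing⇒cycle : ∀ {j S B L} → 1 ≤ L → j + j ≤ suc L → Tree j S B →
                     IncreasingPath S B L → Cycle (2 + L)
  increasing⇒cycle {j} {S} {B} {L} 1≤L 2j≤1+L tree path =
    subst Cycle total (close to-b back meet-tree)
    where
    open IncreasingPath path
    ends : key (xs 0) < key (xs L)
    ends = <-≤-trans (≤∧≢⇒< (key≤ 1≤L) λ eq → vert≢ 1≤L (cong vert (key-injective tree (xs∈ z≤n) (xs∈ 1≤L) eq)))
                     (monotone (key ∘ xs) L key≤ 1≤L ≤-refl)
    split = branching tree (xs∈ z≤n) (xs∈ ≤-refl) ends
    s = proj₁ split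
    s<j = proj₁ (proj₂ split)
    s+s<L : s + s < L
    s+s<L = s≤s⁻¹ (≤-trans (≤-reflexive (cong suc (sym (+-suc s s)))) (≤-trans (+-mono-≤ s<j s<j) 2j≤1+L))
    key-mono : ∀ t {m} → m < L → key (anc t (xs m)) ≤ key (anc t (xs (suc m)))
    key-mono t {m} m<L = key-anc-mono t (xs m) (xs (suc m)) (key≤ m<L)
    d = L ∸ (s + s)
    -- The ancestors at height `s` have weakly increasing keys that differ at the two ends, so some
    -- window of length `d` separates them.
    window = window-jump (key ∘ anc s ∘ xs) L (key-mono s) (proj₂ (proj₂ (proj₂ split))) (m<n⇒0<n∸m s+s<L) (m∸n≤m L (s + s))
    a = proj₁ window
    b = a + d
    b≤L : b ≤ L
    b≤L = proj₁ (proj₂ window)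
    a≤b : a ≤ b
    a≤b = m≤m+n a d
    xa∈ = xs∈ (≤-trans a≤b b≤L)
    xb∈ = xs∈ b≤L
    -- At height `s + 1` the keys are also monotone and agree at both ends, hence are constant along
    -- the path.
    key-b≤a : key (anc (suc s) (xs b)) ≤ key (anc (suc s) (xs a))
    key-b≤a = begin
      key (anc (suc s) (xs b)) ≤⟨ monotone (key ∘ anc (suc s) ∘ xs) L (key-mono (suc s)) b≤L ≤-refl ⟩
      key (anc (suc s) (xs L)) ≡⟨ proj₁ (proj₂ (proj₂ split)) ⟨
      key (anc (suc s) (xs 0)) ≤⟨ monotone (key ∘ anc (suc s) ∘ xs) L (key-mono (suc s)) z≤n (≤-trans a≤b b≤L) ⟩
      key (anc (suc s) (xs a)) ∎
      where open ≤-Reasoning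
    same : anc (suc s) (xs b) ≡ anc (suc s) (xs a)
    same = key-anc-injective (suc s) s<j tree xb∈ xa∈
      (≤-antisym key-b≤a (monotone (key ∘ anc (suc s) ∘ xs) L (key-mono (suc s)) a≤b b≤L))
    differ : anc s (xs b) ≢ anc s (xs a)
    differ eq = <-irrefl (cong key (sym eq)) (proj₂ (proj₂ window))
    d≡ : suc (d ∸ 1) ≡ d
    d≡ = m+[n∸m]≡n (m<n⇒0<n∸m s+s<L)
    to-b : Path (vert (xs a)) (vert (xs b)) (segment a d)
    to-b = subst (λ d → Path (vert (xs a)) (vert (xs (a + d))) (segment a d)) d≡
             (segment-path a (d ∸ 1) (subst (λ d → a + d ≤ L) (sym d≡) b≤L))
    back : Path (vert (xs b)) (vert (xs a)) (chain (suc s) (xs b) ++ reverse (chain (suc s) (xs a)))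
    back = concat (climb s s<j tree xb∈)
      (subst (λ w → Path (vert w) (vert (xs a)) (reverse (chain (suc s) (xs a)))) (sym same) (path-reverse (climb s s<j tree xa∈)))
      λ A∈ C∈ → chains-meet s s<j tree xb∈ xa∈ same differ A∈ (reverse⁻ C∈)
    -- A vertex shared with a chain lies in the tree, hence is a leaf, and the only leaf on a chain
    -- is its starting point.
    meet-tree : ∀ {A C v} → A ∈ˡ segment a d → C ∈ˡ chain (suc s) (xs b) ++ reverse (chain (suc s) (xs a)) →
                v ∈ A → v ∈ C → v ≡ vert (xs a) ⊎ v ≡ vert (xs b)
    meet-tree A∈ C∈ v∈A v∈C with ∈-segment a d A∈
    ... | m , a≤m , m<b , refl with ∈-++⁻ (chain (suc s) (xs b)) C∈
    ... | inj₁ C∈b with ∈-map⁻ vert (gs∩B (<-≤-trans m<b b≤L) v∈A (chain⊆B (suc s) s<j tree xb∈ C∈b v∈C))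
    ... | y , y∈ , refl = inj₂ (leaf-in-chain (suc s) s<j tree xb∈ y∈ C∈b v∈C)
    meet-tree A∈ C∈ v∈A v∈C | m , a≤m , m<b , refl | inj₂ C∈a
      with ∈-map⁻ vert (gs∩B (<-≤-trans m<b b≤L) v∈A (chain⊆B (suc s) s<j tree xa∈ (reverse⁻ C∈a) v∈C))
    ... | y , y∈ , refl = inj₁ (leaf-in-chain (suc s) s<j tree xa∈ y∈ (reverse⁻ C∈a) v∈C)
    total : length (segment a d) + length (chain (suc s) (xs b) ++ reverse (chain (suc s) (xs a))) ≡ 2 + L
    total = begin
      length (segment a d) + length (chain (suc s) (xs b) ++ reverse (chain (suc s) (xs a)))
        ≡⟨ cong₂ _+_ (length-segment a d) (trans (length-++ (chain (suc s) (xs b)))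
             (cong₂ _+_ (length-chain (suc s) (xs b)) (trans (length-reverse (chain (suc s) (xs a))) (length-chain (suc s) (xs a))))) ⟩
      d + (suc s + suc s)   ≡⟨ cong (λ t → d + suc t) (+-suc s s) ⟩
      d + (2 + (s + s))     ≡⟨ +-suc d (suc (s + s)) ⟩
      suc (d + suc (s + s)) ≡⟨ cong suc (+-suc d (s + s)) ⟩
      2 + (d + (s + s))     ≡⟨ cong (2 +_) (m∸n+n≡m (<⇒≤ s+s<L)) ⟩
      2 + L                 ∎
      where open ≡-Reasoning

-- Independent sets in hypergraphs of bounded codegree

module BoundedCodegree
  {N : ℕ} (E : Subset N → Set) (E? : ∀ g → Dec (E g)) (r D : ℕ)
  (∣edge∣≤r : ∀ {g} → E g → ∣ g ∣ ≤ r)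
  (2≤∣edge∣ : ∀ {g} → E g → 2 ≤ ∣ g ∣)
  (cover : Fin N → Fin N → List (Fin N))
  (∣cover∣≤D : ∀ x y → length (cover x y) ≤ D)
  (∈-cover : ∀ {x y g v} → x ≢ y → E g → x ∈ g → y ∈ g → v ∈ g → v ∈ˡ cover x y)
  where

  length-edge≤r : ∀ {g} → E g → length (elems g) ≤ r
  length-edge≤r {g} Eg = subst (_≤ r) (sym (length-elems g)) (∣edge∣≤r Eg)

  vertex-outside : ∀ {g} → E g → ∀ ys → length ys ≤ 1 → ∃ λ u → u ∈ g × u ∉ˡ ys
  vertex-outside {g} Eg ys len
    with fresh id ys (Uniqueₚ.map⁺ id (elems-unique g)) (≤-trans (s≤s len) (subst (2 ≤_) (sym (length-elems g)) (2≤∣edge∣ Eg)))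
  ... | u , u∈ , u∉ = u , ∈-elems⁻ g u∈ , u∉

  module Stage (U : List (Fin N)) where

    open Trees E r U public

    module Leaves {j S B} (tree : Tree j S B) (L : ℕ) where

      -- One for the current vertex, plus `D` for each of at most `L * r` forbidden vertices: those
      -- in a common edge with it and the current vertex.
      K : ℕ
      K = suc (L * r * D)

      Joins : Node N → Node N → Subset N → Set
      Joins x y g = E g × vert x ∈ g × vert y ∈ g × (∀ {v} → v ∈ g → v ∈ˡ B → v ∈ˡ map vert S)

      -- Equality of vertices is included because `Pruning` asks for a reflexive relation; it also
      -- makes the vertices of an independent list distinct.
      Adj : Node N → Node N → Set
      Adj x y = vert x ≡ vert y ⊎ ∃ (Joins x y)

      adj? : ∀ x y → Dec (Adj x y)
      adj? x y = (vert x Finₚ.≟ vert y) ⊎-dec anySubset? λ g →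
        E? g ×-dec (vert x ∈? g) ×-dec (vert y ∈? g) ×-dec all∈? (λ v → (v ∈ˡ? B) →-dec (v ∈ˡ? map vert S)) g

      open Pruning Adj adj? (λ _ → inj₁ refl) key K

      avoided : Node N → List (Fin N) → List (Fin N)
      avoided x F = vert x ∷ concatMap (cover (vert x)) F

      length-avoided : ∀ m F x → length F + m * r ≤ L * r → length (avoided x F) ≤ K
      length-avoided m F x le = s≤s (≤-trans (length-concatMap≤ (cover (vert x)) D (∣cover∣≤D (vert x)) F)
        (*-monoˡ-≤ D (≤-trans (m≤m+n (length F) (m * r)) le)))

      -- A vertex of high^ (m + 1) has more up-neighbours in high^ m than there are vertices
      -- sharing an edge with it and a forbidden vertex, so the path can always be continued.
      increasing-path : ∀ m {x F} → x ∈ˡ high^ m S → vert x ∉ˡ F → length F + m * r ≤ L * r →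
        Σ (IncreasingPath S B m) λ P → IncreasingPath.xs P 0 ≡ x ×
          (∀ {i v} → i < m → v ∈ IncreasingPath.gs P i → v ∉ˡ F)
      increasing-path zero {x} x∈ _ _ = record
        { xs = λ _ → x ; gs = λ _ → ⊥ ; xs∈ = λ _ → x∈ ; key≤ = λ () ; gs-edge = λ () ; left∈ = λ () ; right∈ = λ ()
        ; vert≢ = λ () ; gs∩B = λ () ; meet = λ _ () } , refl , λ ()
      increasing-path (suc m) {x} {F} x∈ x∉F size
        with ∈-filter⁻ (high? (high^ m S)) {xs = high^ m S} x∈
      ... | x∈m , K<deg
        with fresh vert (avoided x F)
               (AllPairsₚ.map⁺ (AllPairsₚ.filter⁺ (up? x) (high^-allPairs m (AllPairsₚ.map⁻ (vert-unique tree)))))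
               (≤-<-trans (length-avoided (suc m) F x size) K<deg)
      ... | y , y∈up , y∉avoided with ∈-filter⁻ (up? x) {xs = high^ m S} y∈up
      ... | y∈m , κ≤ , inj₁ eq = contradiction (here (sym eq)) y∉avoided
      ... | y∈m , κ≤ , inj₂ (g , Eg , x∈g , y∈g , g∩B)
        = extended (increasing-path m {y} {F′} y∈m y∉F′ size′)
        where
        g-avoids-F : ∀ {v} → v ∈ g → v ∉ˡ F
        g-avoids-F {v} v∈g v∈F with vert x Finₚ.≟ v
        ... | yes refl = x∉F v∈F
        ... | no x≢v   = y∉avoided (there (∈-concatMap⁺ (cover (vert x)) (lose v∈F (∈-cover x≢v Eg x∈g v∈g y∈g))))
        -- All of `g` except the next start `y` becomes forbidden. These at most `r` vertices are
        -- paid for by the one step used up.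
        others = filter (λ v → ¬? (v Finₚ.≟ vert y)) (elems g)
        F′ = others ++ F
        y∉F′ : vert y ∉ˡ F′
        y∉F′ y∈ with ∈-++⁻ others y∈
        ... | inj₁ i = proj₂ (∈-filter⁻ (λ v → ¬? (v Finₚ.≟ vert y)) {xs = elems g} i) refl
        ... | inj₂ i = g-avoids-F y∈g i
        size′ : length F′ + m * r ≤ L * r
        size′ = begin
          length F′ + m * r                     ≡⟨ cong (_+ m * r) (length-++ others) ⟩
          length others + length F + m * r      ≤⟨ +-monoˡ-≤ (m * r) (+-monoˡ-≤ (length F)
            (≤-trans (length-filter (λ v → ¬? (v Finₚ.≟ vert y)) (elems g)) (length-edge≤r Eg))) ⟩
          r + length F + m * r                  ≡⟨ cong (_+ m * r) (+-comm r (length F)) ⟩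
          length F + r + m * r                  ≡⟨ +-assoc (length F) r (m * r) ⟩
          length F + suc m * r                  ≤⟨ size ⟩
          L * r                                 ∎
          where open ≤-Reasoning
        extended : (Σ (IncreasingPath S B m) λ P → IncreasingPath.xs P 0 ≡ y ×
                     (∀ {i v} → i < m → v ∈ IncreasingPath.gs P i → v ∉ˡ F′)) → _
        extended (P , refl , avoids) = record
          { xs = xs′ ; gs = gs′
          ; xs∈ = λ { {zero} _ → high^-⊆ m S x∈m ; {suc i} (s≤s le) → xs∈ le }
          ; key≤ = λ { {zero} _ → κ≤ ; {suc i} (s≤s lt) → key≤ lt }
          ; gs-edge = λ { {zero} _ → Eg ; {suc i} (s≤s lt) → gs-edge lt }
          ; left∈ = λ { {zero} _ → x∈g ; {suc i} (s≤s lt) → left∈ lt }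
          ; right∈ = λ { {zero} _ → y∈g ; {suc i} (s≤s lt) → right∈ lt }
          ; vert≢ = λ { {zero} _ eq → y∉avoided (here (sym eq)) ; {suc i} (s≤s lt) → vert≢ lt }
          ; gs∩B = λ { {zero} _ → g∩B ; {suc i} (s≤s lt) → gs∩B′ lt }
          ; meet = λ { {zero} {suc i} _ (s≤s lt) → meet-first lt ; {suc i} {suc i′} (s≤s i<i′) (s≤s lt) → meet i<i′ lt }
          } , refl , λ { {zero} _ → g-avoids-F ; {suc i} (s≤s lt) v∈ v∈F → avoids lt v∈ (∈-++⁺ʳ others v∈F) }
          where
          open IncreasingPath P renaming (gs∩B to gs∩B′)
          xs′ : ℕ → Node N
          xs′ zero    = x
          xs′ (suc i) = xs i
          gs′ : ℕ → Subset N
          gs′ zero    = g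
          gs′ (suc i) = gs i
          meet-first : ∀ {i v} → i < m → v ∈ g → v ∈ gs i → v ≡ vert (xs 0)
          meet-first {v = v} lt v∈g v∈gs with v Finₚ.≟ vert (xs 0)
          ... | yes eq = eq
          ... | no v≢  = contradiction (∈-++⁺ˡ (∈-filter⁺ (λ v → ¬? (v Finₚ.≟ vert (xs 0))) (∈-elems⁺ v∈g) v≢)) (avoids lt v∈gs)

      -- A leaf surviving `L` rounds would start an increasing path with `L` edges and hence yield a
      -- cycle, so `high^ L S` is empty.
      independent-leaves : 1 ≤ L → j + j ≤ suc L → ¬ LoosePaths.Cycle E (2 + L) →
        Σ (List (Node N)) λ I → IndependentIn S I × length S ≤ L * K * length I
      independent-leaves 1≤L 2j≤1+L no-cycle with high^ L S in eq
      ... | [] = independent L S eq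
      ... | x ∷ _ = contradiction (increasing⇒cycle 1≤L 2j≤1+L tree
              (proj₁ (increasing-path L {x} {[]} (subst (x ∈ˡ_) (sym eq) (here refl)) (λ ()) ≤-refl))) no-cycle

    -- A link that can still be added below `y`: beyond the old tree `B` it avoids everything that
    -- the layer under construction already covers.
    Candidate : List (Fin N) → List (Fin N) → Subset N → Node N → Set
    Candidate B B′ g y = E g × (∀ {v} → v ∈ g → v ∈ˡ U) × vert y ∈ g × (∀ {v} → v ∈ g → v ∈ˡ B → v ≡ vert y)
                       × (∀ {v} → v ∈ g → v ∈ˡ B′ → v ∈ˡ B)

    candidate? : ∀ B B′ g y → Dec (Candidate B B′ g y)
    candidate? B B′ g y = E? g ×-dec all∈? (_∈ˡ? U) g ×-dec (vert y ∈? g)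
      ×-dec all∈? (λ v → (v ∈ˡ? B) →-dec (v Finₚ.≟ vert y)) g ×-dec all∈? (λ v → (v ∈ˡ? B′) →-dec (v ∈ˡ? B)) g

    Saturated : List (Node N) → List (Fin N) → List (Fin N) → Set
    Saturated S B B′ = ∀ {g y} → y ∈ˡ S → ¬ Candidate B B′ g y

    add-child : ∀ {S B S′ B′ g y u} → Layer S B S′ B′ → y ∈ˡ S → Candidate B B′ g y →
                u ∈ g → u ∉ˡ vert y ∷ [] → Layer S B (node u g y ∷ S′) (elems g ++ B′)
    add-child {S} {B} {S′} {B′} {g} {y} {u} layer y∈ (Eg , g⊆U , y∈g , g∩B , g∩B′) u∈g u∉y = record
      { child = λ { (here refl) → new ; (there x∈) → old x∈ }
      ; B⊆B′ = ∈-++⁺ʳ (elems g) ∘ B⊆B′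
      ; petals = λ { (here refl) (here refl) _ _ _ → refl
                   ; (here refl) (there y∈) v∈ v∈′ v∉B → contradiction (g∩B′ v∈ (link⊆B′ y∈ v∈′)) v∉B
                   ; (there x∈) (here refl) v∈ v∈′ v∉B → contradiction (g∩B′ v∈′ (link⊆B′ x∈ v∈)) v∉B
                   ; (there x∈) (there y∈) → petals x∈ y∈ }
      ; unique = All.tabulate u∉ ∷ unique
      ; size = size′ }
      where
      open Layer layer
      u∉B : u ∉ˡ B
      u∉B u∈B = u∉y (here (g∩B u∈g u∈B))
      new : Child S B (elems g ++ B′) (node u g y)
      new = record { parent∈ = y∈ ; link-edge = Eg ; link-in = g⊆U ; parent∈link = y∈g ; link∩B = g∩B
                   ; vert∈link = u∈g ; vert∉B = u∉B ; link⊆B′ = ∈-++⁺ˡ ∘ ∈-elems⁺ }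
      old : ∀ {x} → x ∈ˡ S′ → Child S B (elems g ++ B′) x
      old x∈ = record { parent∈ = parent∈ x∈ ; link-edge = link-edge x∈ ; link-in = link-in x∈ ; parent∈link = parent∈link x∈
                      ; link∩B = link∩B x∈ ; vert∈link = vert∈link x∈ ; vert∉B = vert∉B x∈
                      ; link⊆B′ = ∈-++⁺ʳ (elems g) ∘ link⊆B′ x∈ }
      u∉ : ∀ {v} → v ∈ˡ map vert S′ → u ≢ v
      u∉ v∈ refl with ∈-map⁻ vert v∈
      ... | z , z∈ , refl = u∉B (g∩B′ u∈g (link⊆B′ z∈ (vert∈link z∈)))
      size′ : length (elems g ++ B′) ≤ length B + suc (length S′) * r
      size′ = begin
        length (elems g ++ B′)             ≡⟨ length-++ (elems g) ⟩
        length (elems g) + length B′       ≤⟨ +-mono-≤ (length-edge≤r Eg) size ⟩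
        r + (length B + length S′ * r)     ≡⟨ +-assoc r (length B) _ ⟨
        r + length B + length S′ * r       ≡⟨ cong (_+ length S′ * r) (+-comm r (length B)) ⟩
        length B + r + length S′ * r       ≡⟨ +-assoc (length B) r _ ⟩
        length B + suc (length S′) * r     ∎
        where open ≤-Reasoning

    -- The number `m` bounds the remaining additions: the children of a layer have distinct
    -- vertices, so there are never more than `N` of them.
    saturate : ∀ {S B S′ B′} m → N < length S′ + m → Layer S B S′ B′ →
               ∃ λ S″ → ∃ λ B″ → Layer S B S″ B″ × Saturated S B B″
    saturate {S′ = S′} zero N< layer =
      contradiction (unique⇒length≤n (Layer.unique layer))
        (<⇒≱ (subst (N <_) (trans (+-identityʳ _) (sym (length-map vert S′))) N<))
    saturate {S} {B} {S′} {B′} (suc m) N< layer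
      with anySubset? (λ g → Any.any? (candidate? B B′ g) S)
    ... | no none = S′ , B′ , layer , λ y∈ cand → none (_ , lose y∈ cand)
    ... | yes (g , some) with find some
    ... | y , y∈ , cand =
      let u , u∈g , u∉y = vertex-outside (proj₁ cand) (vert y ∷ []) ≤-refl
      in saturate m (subst (N <_) (+-suc (length S′) m) N<) (add-child layer y∈ cand u∈g u∉y)

    saturated-layer : ∀ S B → ∃ λ S′ → ∃ λ B′ → Layer S B S′ B′ × Saturated S B B′
    saturated-layer S B = saturate (suc N) ≤-refl record
      { child = λ () ; B⊆B′ = λ v∈ → v∈ ; petals = λ () ; unique = [] ; size = ≤-reflexive (sym (+-identityʳ (length B))) }

    root∈B : ∀ {j S B} → Tree j S B → ∃ λ v → v ∈ˡ U × v ∈ˡ B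
    root∈B (seed v∈U) = _ , v∈U , here refl
    root∈B (grow tree layer) with root∈B tree
    ... | v , v∈U , v∈B = v , v∈U , Layer.B⊆B′ layer v∈B

    -- A tree whose saturated next layer fails to grow by more than the factor `t`. Thus tree and
    -- next layer together cover only a constant times `t` vertices per leaf, as `removed` records.
    record Stalled (k t : ℕ) : Set where
      field
        {depth}   : ℕ
        {S S′}    : List (Node N)
        {B B′}    : List (Fin N)
        depth≤k   : depth ≤ k
        tree      : Tree depth S B
        layer     : Layer S B S′ B′
        saturated : Saturated S B B′
        removed   : length B′ ≤ (1 + suc k * r) * t * length S

    -- If every layer were more than t times as large as its predecessor, the tree would outgrow t^(k+1) vertices.
    stall : ∀ {k t j S B} i → i + j ≡ k → 1 ≤ t → N ≤ t ^ suc k → t ^ j ≤ length S →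
            length B ≤ (1 + j * r) * length S → Tree j S B → Stalled k t
    stall {k} {t} {j} {S} {B} i i+j≡k 1≤t N≤ t^j≤ B≤ tree with saturated-layer S B
    ... | S′ , B′ , layer , sat with length S′ ≤? t * length S
    ... | yes S′≤ = record
        { depth≤k = j≤k ; tree = tree ; layer = layer ; saturated = sat ; removed = begin
          length B′                                          ≤⟨ Layer.size layer ⟩
          length B + length S′ * r                           ≤⟨ +-mono-≤ B≤ (*-monoˡ-≤ r S′≤) ⟩
          (1 + j * r) * length S + t * length S * r          ≤⟨ +-mono-≤
            (*-mono-≤ (s≤s (*-monoˡ-≤ r j≤k)) (m≤n*m (length S) t ⦃ >-nonZero 1≤t ⦄)) (≤-reflexive (*-comm (t * length S) r)) ⟩
          (1 + k * r) * (t * length S) + r * (t * length S)  ≡⟨ *-distribʳ-+ (t * length S) (1 + k * r) r ⟨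
          (1 + k * r + r) * (t * length S)                   ≡⟨ cong (λ m → suc m * (t * length S)) (+-comm (k * r) r) ⟩
          (1 + suc k * r) * (t * length S)                   ≡⟨ *-assoc (1 + suc k * r) t (length S) ⟨
          (1 + suc k * r) * t * length S                     ∎ }
      where
      open ≤-Reasoning
      j≤k : j ≤ k
      j≤k = subst (j ≤_) i+j≡k (m≤n+m j i)
    ... | no S′≰ with i
    ...   | zero = contradiction (unique⇒length≤n (Layer.unique layer)) (<⇒≱ (begin-strict
            N                    ≤⟨ N≤ ⟩
            t * t ^ k            ≡⟨ cong (λ m → t * t ^ m) i+j≡k ⟨
            t * t ^ j            ≤⟨ *-monoʳ-≤ t t^j≤ ⟩
            t * length S         <⟨ ≰⇒> S′≰ ⟩
            length S′            ≡⟨ length-map vert S′ ⟨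
            length (map vert S′) ∎))
      where open ≤-Reasoning
    ...   | suc i′ = stall i′ (trans (+-suc i′ j) i+j≡k) 1≤t N≤ (≤-trans (*-monoʳ-≤ t t^j≤) tS≤S′) (begin
            length B′                                   ≤⟨ Layer.size layer ⟩
            length B + length S′ * r                    ≤⟨ +-monoˡ-≤ (length S′ * r) (≤-trans B≤ (*-monoʳ-≤ (1 + j * r) S≤S′)) ⟩
            (1 + j * r) * length S′ + length S′ * r     ≡⟨ cong ((1 + j * r) * length S′ +_) (*-comm (length S′) r) ⟩
            (1 + j * r) * length S′ + r * length S′     ≡⟨ *-distribʳ-+ (length S′) (1 + j * r) r ⟨
            (1 + j * r + r) * length S′                 ≡⟨ cong (λ m → suc m * length S′) (+-comm (j * r) r) ⟩
            (1 + suc j * r) * length S′                 ∎) (grow tree layer)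
      where
      open ≤-Reasoning
      tS≤S′ : t * length S ≤ length S′
      tS≤S′ = <⇒≤ (≰⇒> S′≰)
      S≤S′ : length S ≤ length S′
      S≤S′ = ≤-trans (m≤n*m (length S) t ⦃ >-nonZero 1≤t ⦄) tS≤S′

  -- Peeling off trees

  module _ (k t L : ℕ) (1≤L : 1 ≤ L) (2k≤1+L : k + k ≤ suc L) (1≤t : 1 ≤ t) (N≤ : N ≤ t ^ suc k)
           (no-cycle : ¬ LoosePaths.Cycle E (2 + L)) where

    -- Vertices deleted per vertex kept: the factor in `removed` times the loss in
    -- `independent-leaves`.
    ratio : ℕ
    ratio = (1 + suc k * r) * t * (L * suc (L * r * D))

    Independent : List (Fin N) → Set
    Independent J = ∀ {g} → E g → ¬ (∀ {v} → v ∈ g → v ∈ˡ J)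

    module Peel {U : List (Fin N)} (uniqueU : Unique U) (stalled : Stage.Stalled U k t) where

      open Stage U
      open Stalled stalled
      open Layer layer using (B⊆B′)
      open Leaves tree L

      kept? : ∀ v → Dec (v ∉ˡ B′)
      kept? v = ¬? (v ∈ˡ? B′)

      U′ : List (Fin N)
      U′ = filter kept? U

      -- The root is always deleted, so the peeling terminates.
      shorter : length U′ < length U
      shorter with root∈B tree
      ... | v , v∈U , v∈B = filter-notAll kept? U (lose v∈U λ v∉B′ → v∉B′ (B⊆B′ v∈B))

      U⊆ : ∀ {v} → v ∈ˡ U → v ∈ˡ U′ ++ B′
      U⊆ {v} v∈ with v ∈ˡ? B′
      ... | yes v∈B′ = ∈-++⁺ʳ U′ v∈B′
      ... | no v∉B′  = ∈-++⁺ˡ (∈-filter⁺ kept? v∈ v∉B′)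

      module _ {I : List (Node N)} (I⊆S : ∀ {x} → x ∈ˡ I → x ∈ˡ S) (I-pairs : AllPairs (λ x y → ¬ Adj x y) I)
               (S≤ : length S ≤ L * K * length I)
               {J′ : List (Fin N)} (uniqueJ′ : Unique J′) (J′⊆U′ : ∀ {v} → v ∈ˡ J′ → v ∈ˡ U′)
               (independentJ′ : Independent J′) (U′≤ : length U′ ≤ ratio * length J′) where

        J : List (Fin N)
        J = map vert I ++ J′

        J′⊆ : ∀ {v} → v ∈ˡ J′ → v ∈ˡ U × v ∉ˡ B′
        J′⊆ v∈ = ∈-filter⁻ kept? {xs = U} (J′⊆U′ v∈)

        I⊆B : ∀ {v} → v ∈ˡ map vert I → v ∈ˡ B
        I⊆B v∈ with ∈-map⁻ vert v∈
        ... | x , x∈ , refl = vert∈B tree (I⊆S x∈)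

        unique-J : Unique J
        unique-J = Uniqueₚ.++⁺ (AllPairsₚ.map⁺ (AllPairs.map (λ ¬adj → ¬adj ∘ inj₁) I-pairs)) uniqueJ′
          λ (v∈I , v∈J′) → proj₂ (J′⊆ v∈J′) (B⊆B′ (I⊆B v∈I))

        J⊆U : ∀ {v} → v ∈ˡ J → v ∈ˡ U
        J⊆U v∈ with ∈-++⁻ (map vert I) v∈
        ... | inj₂ v∈J′ = proj₁ (J′⊆ v∈J′)
        ... | inj₁ v∈I with ∈-map⁻ vert v∈I
        ... | x , x∈ , refl = vert∈U tree (I⊆S x∈)

        in-I : ∀ {w} → w ∈ˡ J → w ∈ˡ B′ → w ∈ˡ map vert I
        in-I w∈J w∈B′ with ∈-++⁻ (map vert I) w∈J
        ... | inj₁ w∈I  = w∈I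
        ... | inj₂ w∈J′ = contradiction w∈B′ (proj₂ (J′⊆ w∈J′))

        in-S : ∀ {w} → w ∈ˡ J → w ∈ˡ B → w ∈ˡ map vert S
        in-S w∈J w∈B with ∈-map⁻ vert (in-I w∈J (B⊆B′ w∈B))
        ... | z , z∈ , refl = ∈-map⁺ vert (I⊆S z∈)

        -- Two kept leaves in `g` would be adjacent through `g`, since an edge inside `J` meets the
        -- tree only in leaves.
        only : ∀ {g x w} → E g → (∀ {v} → v ∈ g → v ∈ˡ J) → x ∈ˡ I → vert x ∈ g → w ∈ g → w ∈ˡ B → w ≡ vert x
        only {g} Eg sub x∈ x∈g w∈g w∈B with ∈-map⁻ vert (in-I (sub w∈g) (B⊆B′ w∈B))
        ... | y , y∈ , refl with allPairs-lookup I-pairs x∈ y∈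
        ... | inj₁ refl        = refl
        ... | inj₂ (inj₁ ¬adj) = ⊥-elim (¬adj (inj₂ (g , Eg , x∈g , w∈g , λ v∈ → in-S (sub v∈))))
        ... | inj₂ (inj₂ ¬adj) = ⊥-elim (¬adj (inj₂ (g , Eg , w∈g , x∈g , λ v∈ → in-S (sub v∈))))

        -- An edge inside `J` through a kept leaf meets the tree only there, and `J′` avoids all of
        -- `B′`. It would thus be a candidate for the next layer, which is saturated.
        misses-I : ∀ {g v} → E g → (∀ {v} → v ∈ g → v ∈ˡ J) → v ∈ g → v ∉ˡ map vert I
        misses-I Eg sub v∈g v∈I =
          let x , x∈ , eq = ∈-map⁻ vert v∈I
              x∈g = subst (_∈ _) eq v∈g
          in saturated (I⊆S x∈) (Eg , (λ w∈ → J⊆U (sub w∈)) , x∈g , only Eg sub x∈ x∈g , λ w∈g w∈B′ → I⊆B (in-I (sub w∈g) w∈B′))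

        independent-J : Independent J
        independent-J Eg sub = independentJ′ Eg λ v∈g → in-J′ v∈g (∈-++⁻ (map vert I) (sub v∈g))
          where
          in-J′ : ∀ {v} → v ∈ _ → v ∈ˡ map vert I ⊎ v ∈ˡ J′ → v ∈ˡ J′
          in-J′ v∈g (inj₁ v∈I)  = contradiction v∈I (misses-I Eg sub v∈g)
          in-J′ v∈g (inj₂ v∈J′) = v∈J′

        bound : length U ≤ ratio * length J
        bound = begin
          length U                                        ≤⟨ unique-⊆⇒length≤ uniqueU U⊆ ⟩
          length (U′ ++ B′)                               ≡⟨ length-++ U′ ⟩
          length U′ + length B′                           ≤⟨ +-mono-≤ U′≤
            (≤-trans removed (*-monoʳ-≤ ((1 + suc k * r) * t) S≤)) ⟩
          ratio * length J′ + (1 + suc k * r) * t * (L * K * length I)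
                                                          ≡⟨ cong (ratio * length J′ +_) (*-assoc ((1 + suc k * r) * t) (L * K) (length I)) ⟨
          ratio * length J′ + ratio * length I            ≡⟨ *-distribˡ-+ ratio (length J′) (length I) ⟨
          ratio * (length J′ + length I)                  ≡⟨ cong (ratio *_) (+-comm (length J′) (length I)) ⟩
          ratio * (length I + length J′)                  ≡⟨ cong (λ m → ratio * (m + length J′)) (length-map vert I) ⟨
          ratio * (length (map vert I) + length J′)       ≡⟨ cong (ratio *_) (length-++ (map vert I)) ⟨
          ratio * length J                                ∎
          where open ≤-Reasoning

    LargeIndependent : List (Fin N) → Set
    LargeIndependent U = Σ (List (Fin N)) λ J →
      Unique J × (∀ {v} → v ∈ˡ J → v ∈ˡ U) × Independent J × length U ≤ ratio * length J

    peel : ∀ {U} → Unique U → (stalled : Stage.Stalled U k t) →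
           (∀ {U′} → length U′ < length U → Unique U′ → LargeIndependent U′) → LargeIndependent U
    peel {U} uniqueU stalled rec =
      let open Stage U
          open Stalled stalled
          open Leaves tree L
          open Peel uniqueU stalled
          I , (I⊆S , I-pairs) , S≤ = independent-leaves 1≤L (≤-trans (+-mono-≤ depth≤k depth≤k) 2k≤1+L) no-cycle
          J′ , uniqueJ′ , J′⊆U′ , independentJ′ , U′≤ = rec {U′} shorter (Uniqueₚ.filter⁺ kept? uniqueU)
      in J I⊆S I-pairs S≤ uniqueJ′ J′⊆U′ independentJ′ U′≤
       , unique-J I⊆S I-pairs S≤ uniqueJ′ J′⊆U′ independentJ′ U′≤
       , J⊆U I⊆S I-pairs S≤ uniqueJ′ J′⊆U′ independentJ′ U′≤
       , independent-J I⊆S I-pairs S≤ uniqueJ′ J′⊆U′ independentJ′ U′≤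
       , bound I⊆S I-pairs S≤ uniqueJ′ J′⊆U′ independentJ′ U′≤

    large-independent : ∀ m U → length U ≤ m → Unique U → LargeIndependent U
    large-independent m [] _ _ = [] , [] , (λ ()) , no-edge , z≤n
      where
      no-edge : Independent []
      no-edge Eg sub with vertex-outside Eg [] z≤n
      ... | u , u∈g , _ with sub u∈g
      ... | ()
    large-independent (suc m) U@(_ ∷ _) len uniqueU =
      peel uniqueU (Stage.stall U k (+-identityʳ k) 1≤t N≤ ≤-refl ≤-refl (Stage.seed (here refl)))
        λ {U′} lt → large-independent m U′ (s≤s⁻¹ (<-≤-trans lt len))

-- Size bound for `kernelCover` with `m` levels: a flexible set has at most `r` vertices, and a
-- blocked one branches over at most `f` vertices.
coverSize : ℕ → ℕ → ℕ → ℕ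
coverSize r f zero    = 0
coverSize r f (suc m) = r + f * coverSize r f m

⊈⇒∃ : ∀ {n} {A B : Subset n} → ¬ A ⊆ B → ∃ λ x → x ∈ A × x ∉ B
⊈⇒∃ {A = A} {B} A⊈B with Finₚ.any? (λ x → (x ∈? A) ×-dec ¬? (x ∈? B))
... | yes found = found
... | no none   = ⊥-elim (A⊈B λ {x} x∈A → decidable-stable (x ∈? B) λ x∉B → none (x , x∈A , x∉B))

-- Kernels

module Kernels {N : ℕ} (χ : Colouring N) (r f : ℕ) where

  RedEdge : Subset N → Set
  RedEdge e = ∣ e ∣ ≡ r × χ e ≡ red

  Extends : Subset N → Subset N → Subset N → Set
  Extends A F e = A ⊆ e × RedEdge e × (∀ {v} → v ∈ F → v ∉ e)

  extension? : ∀ A F → Dec (∃ (Extends A F))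
  extension? A F = anySubset? λ e →
    (A ⊆? e) ×-dec ((∣ e ∣ ≟ r) ×-dec (χ e Boolₚ.≟ red)) ×-dec all∈? (λ v → ¬? (v ∈? e)) F

  Blocks : Subset N → Subset N → Set
  Blocks A F = ∣ F ∣ ≤ f × (∀ {v} → v ∈ F → v ∉ A) × ¬ ∃ (Extends A F)

  blocked? : ∀ A → Dec (∃ (Blocks A))
  blocked? A = anySubset? λ F → (∣ F ∣ ≤? f) ×-dec all∈? (λ v → ¬? (v ∈? A)) F ×-dec ¬? (extension? A F)

  -- Phrased as absence of a blocking set, so that failure supplies the set over which `kernelCover`
  -- branches.
  Flexible : Subset N → Set
  Flexible A = ¬ ∃ (Blocks A)

  flexible-extends : ∀ {A} → Flexible A → ∀ F → ∣ F ∣ ≤ f → (∀ {v} → v ∈ F → v ∉ A) → ∃ (Extends A F)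
  flexible-extends {A} flex F ∣F∣≤f F∩A with extension? A F
  ... | yes ext = ext
  ... | no ¬ext = ⊥-elim (flex (F , ∣F∣≤f , F∩A , ¬ext))

  -- With nothing forbidden, flexibility already places `A` inside a red edge.
  flexible-size : ∀ {A} → Flexible A → ∣ A ∣ ≤ r
  flexible-size {A} flex with flexible-extends flex ⊥ (subst (_≤ f) (sym (∣⊥∣≡0 N)) z≤n) (λ v∈⊥ → contradiction v∈⊥ ∉⊥)
  ... | e , A⊆e , (∣e∣≡r , _) , _ = subst (∣ A ∣ ≤_) ∣e∣≡r (p⊆q⇒∣p∣≤∣q∣ A⊆e)

  red⇒flexible : ∀ {e} → RedEdge e → Flexible e
  red⇒flexible {e} red-e (F , _ , F∩e , ¬ext) = ¬ext (e , id , red-e , F∩e)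

  Smaller : Subset N → Subset N → Set
  Smaller A B = B ⊆ A × ¬ A ⊆ B × 2 ≤ ∣ B ∣ × Flexible B

  smaller? : ∀ A → Dec (∃ (Smaller A))
  smaller? A = anySubset? λ B → (B ⊆? A) ×-dec ¬? (A ⊆? B) ×-dec (2 ≤? ∣ B ∣) ×-dec ¬? (blocked? B)

  Kernel : Subset N → Set
  Kernel A = 2 ≤ ∣ A ∣ × Flexible A × ¬ ∃ (Smaller A)

  kernel? : ∀ A → Dec (Kernel A)
  kernel? A = (2 ≤? ∣ A ∣) ×-dec ¬? (blocked? A) ×-dec ¬? (smaller? A)

  -- Descent through proper flexible subsets, bounded by cardinality.
  contains-kernel : ∀ m {A} → ∣ A ∣ ≤ m → 2 ≤ ∣ A ∣ → Flexible A → ∃ λ B → B ⊆ A × Kernel B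
  contains-kernel m {A} ∣A∣≤m 2≤∣A∣ flex with smaller? A
  ... | no none = A , id , 2≤∣A∣ , flex , none
  ... | yes (B , B⊆A , A⊈B , 2≤∣B∣ , flexB) with m | <-≤-trans (p⊂q⇒∣p∣<∣q∣ (B⊆A , ⊈⇒∃ A⊈B)) ∣A∣≤m
  ... | suc m′ | s≤s ∣B∣≤m with contains-kernel m′ ∣B∣≤m 2≤∣B∣ flexB
  ... | C , C⊆B , kernelC = C , ⊆-trans C⊆B B⊆A , kernelC

  -- A kernel containing a non-flexible B must meet the set blocking B, which bounds the
  -- union of all kernels containing B.
  kernelCover : ℕ → Subset N → List (Fin N)
  kernelCover zero    B = []
  kernelCover (suc m) B with blocked? B
  ... | no _        = elems B
  ... | yes (F , _) = concatMap (λ x → kernelCover m (⁅ x ⁆ ∪ B)) (elems F)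

  length-kernelCover : ∀ m B → length (kernelCover m B) ≤ coverSize r f m
  length-kernelCover zero    B = z≤n
  length-kernelCover (suc m) B with blocked? B
  ... | no flex = ≤-trans (≤-reflexive (length-elems B))
                    (≤-trans (flexible-size flex) (m≤m+n r _))
  ... | yes (F , ∣F∣≤f , _) = begin
      length (concatMap (λ x → kernelCover m (⁅ x ⁆ ∪ B)) (elems F))
        ≤⟨ length-concatMap≤ _ (coverSize r f m) (λ x → length-kernelCover m (⁅ x ⁆ ∪ B)) (elems F) ⟩
      length (elems F) * coverSize r f m ≤⟨ *-monoˡ-≤ (coverSize r f m) (≤-trans (≤-reflexive (length-elems F)) ∣F∣≤f) ⟩
      f * coverSize r f m                ≤⟨ m≤n+m _ r ⟩
      r + f * coverSize r f m            ∎
    where open ≤-Reasoning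

  -- If `B` is flexible, minimality gives `A = B`. Otherwise `A` meets the blocking set `F`, for
  -- else a red edge around `A` would avoid `F`; a common vertex enlarges `B` inside `A`. As kernels
  -- have at most `r` vertices, `r < ∣ B ∣ + m` ensures enough levels.
  ∈-kernelCover : ∀ m {A B} → 2 ≤ ∣ B ∣ → r < ∣ B ∣ + m → Kernel A → B ⊆ A → ∀ {v} → v ∈ A → v ∈ˡ kernelCover m B
  ∈-kernelCover zero {A} {B} _ r< (_ , flex , _) B⊆A v∈A =
    contradiction (≤-trans (p⊆q⇒∣p∣≤∣q∣ B⊆A) (flexible-size flex)) (<⇒≱ (subst (r <_) (+-identityʳ _) r<))
  ∈-kernelCover (suc m) {A} {B} 2≤∣B∣ r< kernelA@(_ , flexA , minimal) B⊆A {v} v∈A with blocked? B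
  ... | no flexB = ∈-elems⁺ (A⊆B v∈A)
    where
    A⊆B : A ⊆ B
    A⊆B = decidable-stable (A ⊆? B) λ A⊈B → minimal (B , B⊆A , A⊈B , 2≤∣B∣ , flexB)
  ... | yes (F , ∣F∣≤f , F∩B , ¬ext) with Finₚ.any? (λ x → (x ∈? F) ×-dec (x ∈? A))
  ...   | no none = ⊥-elim (let e , A⊆e , red-e , F∩e = flexible-extends flexA F ∣F∣≤f λ v∈F v∈A′ → none (_ , v∈F , v∈A′)
                              in ¬ext (e , ⊆-trans B⊆A A⊆e , red-e , F∩e))
  ...   | yes (x , x∈F , x∈A) = ∈-concatMap⁺ (λ x → kernelCover m (⁅ x ⁆ ∪ B)) (lose (∈-elems⁺ x∈F)
            (∈-kernelCover m (≤-trans 2≤∣B∣ (<⇒≤ bigger)) r<′ kernelA B∪x⊆A v∈A))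
    where
    bigger : ∣ B ∣ < ∣ ⁅ x ⁆ ∪ B ∣
    bigger = p⊂q⇒∣p∣<∣q∣ (q⊆p∪q ⁅ x ⁆ B , x , x∈p∪q⁺ (inj₁ (x∈⁅x⁆ x)) , F∩B x∈F)
    r<′ : r < ∣ ⁅ x ⁆ ∪ B ∣ + m
    r<′ = ≤-trans r< (≤-trans (≤-reflexive (+-suc ∣ B ∣ m)) (+-monoˡ-≤ m bigger))
    B∪x⊆A : ⁅ x ⁆ ∪ B ⊆ A
    B∪x⊆A w∈ with x∈p∪q⁻ ⁅ x ⁆ B w∈
    ... | inj₂ w∈B = B⊆A w∈B
    ... | inj₁ w∈x with x∈⁅y⁆⇒x≡y x w∈x
    ... | refl = x∈A

  pairCover : Fin N → Fin N → List (Fin N)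
  pairCover x y = kernelCover r (fromList (x ∷ y ∷ []))

  ∈-pairCover : ∀ {x y A v} → x ≢ y → Kernel A → x ∈ A → y ∈ A → v ∈ A → v ∈ˡ pairCover x y
  ∈-pairCover {x} {y} {A} x≢y kernelA x∈A y∈A =
    ∈-kernelCover r (≤-reflexive (sym two)) (subst (λ s → r < s + r) (sym two) (m<n+m r (s≤s z≤n))) kernelA pair⊆A
    where
    two : ∣ fromList (x ∷ y ∷ []) ∣ ≡ 2
    two = ∣fromList∣≡length ((x≢y ∷ []) ∷ [] ∷ [])
    pair⊆A : fromList (x ∷ y ∷ []) ⊆ A
    pair⊆A v∈ with ∈-fromList⁻ (x ∷ y ∷ []) v∈
    ... | here refl         = x∈A
    ... | there (here refl) = y∈A

  -- Expanding kernels to red edges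

  module _ {l : ℕ} (lr≤f : l * r ≤ f) (e : Fin l → Subset N) (flex : ∀ i → Flexible (e i)) where

    record Expansion (m : ℕ) : Set where
      field
        e′       : Fin l → Subset N
        flexible : ∀ i → Flexible (e′ i)
        red-edge : ∀ i → toℕ i < m → RedEdge (e′ i)
        larger   : ∀ i → e i ⊆ e′ i
        meets    : ∀ {i j v} → i ≢ j → v ∈ e′ i → v ∈ e′ j → v ∈ e i × v ∈ e j

    -- Forbid every vertex of the current sets outside the `i₀`-th. Flexible sets have at most `r`
    -- vertices, so at most `l * r` are forbidden, and the red edge obtained creates no new
    -- intersection.
    expand-at : ∀ {m} → Expansion m → ∀ i₀ → toℕ i₀ ≡ m → Expansion (suc m)
    expand-at {m} exp i₀ i₀≡m = record
      { e′ = e″ ; flexible = flexible″ ; red-edge = red-edge″ ; larger = larger″ ; meets = meets″ }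
      where
      open Expansion exp
      outside? : ∀ v → Dec (v ∉ e′ i₀)
      outside? v = ¬? (v ∈? e′ i₀)
      others = filter outside? (concatMap (elems ∘ e′) (allFin l))
      ∣others∣≤f : ∣ fromList others ∣ ≤ f
      ∣others∣≤f = begin
        ∣ fromList others ∣                        ≤⟨ ∣fromList∣≤length others ⟩
        length others                              ≤⟨ length-filter outside? (concatMap (elems ∘ e′) (allFin l)) ⟩
        length (concatMap (elems ∘ e′) (allFin l)) ≤⟨ length-concatMap≤ (elems ∘ e′) r
          (λ i → ≤-trans (≤-reflexive (length-elems (e′ i))) (flexible-size (flexible i))) (allFin l) ⟩
        length (allFin l) * r                      ≡⟨ cong (_* r) (length-tabulate {n = l} id) ⟩
        l * r                                      ≤⟨ lr≤f ⟩
        f                                          ∎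
        where open ≤-Reasoning
      ext = flexible-extends (flexible i₀) (fromList others) ∣others∣≤f
              (λ v∈ → proj₂ (∈-filter⁻ outside? {xs = concatMap (elems ∘ e′) (allFin l)} (∈-fromList⁻ others v∈)))
      g : Subset N
      g = proj₁ ext
      e′⊆g : e′ i₀ ⊆ g
      e′⊆g = proj₁ (proj₂ ext)
      red-g : RedEdge g
      red-g = proj₁ (proj₂ (proj₂ ext))
      g-meets : ∀ {j v} → v ∈ g → v ∈ e′ j → v ∈ e′ i₀
      g-meets {j} {v} v∈g v∈j = decidable-stable (v ∈? e′ i₀) λ v∉ →
        proj₂ (proj₂ (proj₂ ext))
          (∈-fromList⁺ (∈-filter⁺ outside? (∈-concatMap⁺ (elems ∘ e′) (lose (∈-allFin j) (∈-elems⁺ v∈j))) v∉)) v∈g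
      e″ : Fin l → Subset N
      e″ i with i Finₚ.≟ i₀
      ... | yes _ = g
      ... | no _  = e′ i
      flexible″ : ∀ i → Flexible (e″ i)
      flexible″ i with i Finₚ.≟ i₀
      ... | yes _ = red⇒flexible red-g
      ... | no _  = flexible i
      red-edge″ : ∀ i → toℕ i < suc m → RedEdge (e″ i)
      red-edge″ i (s≤s i≤m) with i Finₚ.≟ i₀
      ... | yes _   = red-g
      ... | no i≢i₀ = red-edge i (≤∧≢⇒< i≤m λ i≡m → i≢i₀ (Finₚ.toℕ-injective (trans i≡m (sym i₀≡m))))
      larger″ : ∀ i → e i ⊆ e″ i
      larger″ i with i Finₚ.≟ i₀
      ... | yes refl = ⊆-trans (larger i) e′⊆g
      ... | no _     = larger i
      meets″ : ∀ {i j v} → i ≢ j → v ∈ e″ i → v ∈ e″ j → v ∈ e i × v ∈ e j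
      meets″ {i} {j} i≢j v∈i v∈j with i Finₚ.≟ i₀ | j Finₚ.≟ i₀
      ... | yes refl | yes refl = contradiction refl i≢j
      ... | yes refl | no _     = meets i≢j (g-meets v∈i v∈j) v∈j
      ... | no _     | yes refl = meets i≢j v∈i (g-meets v∈j v∈i)
      ... | no _     | no _     = meets i≢j v∈i v∈j

    expand : ∀ m → m ≤ l → Expansion m
    expand zero    _   = record { e′ = e ; flexible = flex ; red-edge = λ _ () ; larger = λ _ → id ; meets = λ _ v∈ v∈′ → v∈ , v∈′ }
    expand (suc m) m<l = expand-at (expand m (<⇒≤ m<l)) (fromℕ< m<l) (Finₚ.toℕ-fromℕ< m<l)

    red-expansion : Σ (Fin l → Subset N) λ e′ → (∀ i → RedEdge (e′ i)) × (∀ i j → i ≢ j → e′ i ∩ e′ j ≡ e i ∩ e j)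
    red-expansion = e′ , (λ i → red-edge i (Finₚ.toℕ<n i)) , same
      where
      open Expansion (expand l ≤-refl)
      same : ∀ i j → i ≢ j → e′ i ∩ e′ j ≡ e i ∩ e j
      same i j i≢j = ⊆-antisym
        (λ v∈ → let v∈i , v∈j = x∈p∩q⁻ (e′ i) (e′ j) v∈ in x∈p∩q⁺ (meets i≢j v∈i v∈j))
        (λ v∈ → let v∈i , v∈j = x∈p∩q⁻ (e i) (e j) v∈ in x∈p∩q⁺ (larger i v∈i , larger j v∈j))

  kernel-cycle⇒red-cycle : ∀ {l} → l * r ≤ f → 3 ≤ l → LoosePaths.Cycle Kernel l → RedLooseCycle r l χ
  kernel-cycle⇒red-cycle {l} lr≤f 3≤l cyc =
    let e , kernels , cyclic = LoosePaths.cycle⇒edges Kernel 3≤l cyc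
        e′ , red-e′ , same = red-expansion lr≤f e (λ i → proj₁ (proj₂ (kernels i)))
    in e′ , ((λ i → proj₁ (red-e′ i)) , λ i j i≢j →
         (λ adj → trans (cong ∣_∣ (same i j i≢j)) (proj₁ (cyclic i j i≢j) adj))
       , (λ ¬adj → trans (same i j i≢j) (proj₂ (cyclic i j i≢j) ¬adj)))
     , λ i → proj₂ (red-e′ i)

-- Decidability of the arrow relation

allSubset? : ∀ {n} {P : Subset n → Set} → (∀ e → Dec (P e)) → Dec (∀ e → P e)
allSubset? P? = map′ (λ none e → decidable-stable (P? e) (λ ¬p → none (e , ¬p))) (λ all (e , ¬p) → ¬p (all e))
                     (¬? (anySubset? (¬? ∘ P?)))

module _ {A : Set} where

  nil : Fin 0 → A
  nil ()

  cons : ∀ {l} → A → (Fin l → A) → Fin (suc l) → A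
  cons a e zero    = a
  cons a e (suc i) = e i

-- Families are enumerated only up to pointwise equality; `resp` takes the place of function
-- extensionality.
anyFamily? : ∀ {N} l {P : (Fin l → Subset N) → Set} → (∀ {e e′} → (∀ i → e i ≡ e′ i) → P e → P e′) →
             (∀ e → Dec (P e)) → Dec (Σ (Fin l → Subset N) P)
anyFamily? zero resp P? = map′ (nil ,_) (λ (e , p) → resp (λ ()) p) (P? nil)
anyFamily? (suc l) resp P? = map′
  (λ (a , e , p) → cons a e , p)
  (λ (e , p) → e zero , e ∘ suc , resp (λ { zero → refl ; (suc i) → refl }) p)
  (anySubset? λ a → anyFamily? l (λ eq → resp λ { zero → refl ; (suc i) → eq i }) (P? ∘ cons a))

-- A colouring on `n + 1` vertices is a pair of colourings on `n`, chosen by membership of the first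
-- vertex.
branch : ∀ {n} → Colouring n → Colouring n → Colouring (suc n)
branch χ₀ χ₁ (b ∷ s) = if b then χ₁ s else χ₀ s

allColourings? : ∀ n {P : Colouring n → Set} → (∀ {χ χ′} → (∀ s → χ s ≡ χ′ s) → P χ → P χ′) →
                 (∀ χ → Dec (P χ)) → Dec (∀ χ → P χ)
allColourings? zero {P} resp P? = map′ to (λ all → all _ , all _) (P? (λ _ → true) ×-dec P? (λ _ → false))
  where
  to : P (λ _ → true) × P (λ _ → false) → ∀ χ → P χ
  to (p , q) χ with χ [] in eq
  ... | true  = resp (λ { [] → sym eq }) p
  ... | false = resp (λ { [] → sym eq }) q
allColourings? (suc n) {P} resp P? = map′
  (λ all χ → resp (λ { (true ∷ s) → refl ; (false ∷ s) → refl }) (all (χ ∘ (false ∷_)) (χ ∘ (true ∷_))))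
  (λ all χ₀ χ₁ → all (branch χ₀ χ₁))
  (allColourings? n
    (λ eq all χ₁ → resp (λ { (true ∷ s) → refl ; (false ∷ s) → eq s }) (all χ₁))
    (λ χ₀ → allColourings? n (λ eq → resp λ { (true ∷ s) → eq s ; (false ∷ s) → refl }) (λ χ₁ → P? (branch χ₀ χ₁))))

module _ (r l : ℕ) {N : ℕ} where

  cycAdj? : (i j : Fin l) → Dec (CycAdj l i j)
  cycAdj? i j = (toℕ j ≟ suc (toℕ i)) ⊎-dec (toℕ i ≟ suc (toℕ j))
    ⊎-dec ((toℕ j ≟ 0) ×-dec (suc (toℕ i) ≟ l)) ⊎-dec ((toℕ i ≟ 0) ×-dec (suc (toℕ j) ≟ l))

  isLooseCycle? : (e : Fin l → Subset N) → Dec (IsLooseCycle r l e)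
  isLooseCycle? e = Finₚ.all? (λ i → ∣ e i ∣ ≟ r) ×-dec Finₚ.all? λ i → Finₚ.all? λ j →
    ¬? (i Finₚ.≟ j) →-dec ((cycAdj? i j →-dec (∣ e i ∩ e j ∣ ≟ 1))
      ×-dec (¬? (cycAdj? i j) →-dec Vecₚ.≡-dec Boolₚ._≟_ (e i ∩ e j) ⊥))

  isLooseCycle-resp : {e e′ : Fin l → Subset N} → (∀ i → e i ≡ e′ i) → IsLooseCycle r l e → IsLooseCycle r l e′
  isLooseCycle-resp eq (sizes , meets) =
      (λ i → trans (cong ∣_∣ (sym (eq i))) (sizes i))
    , (λ i j i≢j → let same = cong₂ _∩_ (sym (eq i)) (sym (eq j)) in
         (λ adj → trans (cong ∣_∣ same) (proj₁ (meets i j i≢j) adj))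
       , (λ ¬adj → trans same (proj₂ (meets i j i≢j) ¬adj)))

  redLooseCycle? : (χ : Colouring N) → Dec (RedLooseCycle r l χ)
  redLooseCycle? χ = anyFamily? l
    (λ eq (cyc , reds) → isLooseCycle-resp eq cyc , λ i → trans (cong χ (sym (eq i))) (reds i))
    (λ e → isLooseCycle? e ×-dec Finₚ.all? λ i → χ (e i) Boolₚ.≟ red)

blueClique? : ∀ r n {N} (χ : Colouring N) → Dec (BlueClique r n χ)
blueClique? r n χ = anySubset? λ S → (∣ S ∣ ≟ n) ×-dec
  allSubset? λ e → (e ⊆? S) →-dec (∣ e ∣ ≟ r) →-dec (χ e Boolₚ.≟ blue)

-- Makes the search for the least `N` in `IsRamseyNumber` constructive.
arrows? : ∀ r l n N → Dec (Arrows r l n N)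
arrows? r l n N = allColourings? N resp λ χ → redLooseCycle? r l χ ⊎-dec blueClique? r n χ
  where
  resp : ∀ {χ χ′ : Colouring N} → (∀ s → χ s ≡ χ′ s) →
         RedLooseCycle r l χ ⊎ BlueClique r n χ → RedLooseCycle r l χ′ ⊎ BlueClique r n χ′
  resp eq (inj₁ (e , cyc , reds)) = inj₁ (e , cyc , λ i → trans (sym (eq (e i))) (reds i))
  resp eq (inj₂ (S , size , blues)) = inj₂ (S , size , λ e e⊆S ∣e∣≡r → trans (sym (eq e)) (blues e e⊆S ∣e∣≡r))

-- Integer roots and the passage to Ramsey numbers

^-distribʳ-* : ∀ j m n → (m * n) ^ j ≡ m ^ j * n ^ j
^-distribʳ-* zero    m n = refl
^-distribʳ-* (suc j) m n = trans (cong (m * n *_) (^-distribʳ-* j m n)) ([m*n]*[o*p]≡[m*o]*[n*p] m n (m ^ j) (n ^ j))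

module _ {P : ℕ → Set} (P? : ∀ m → Dec (P m)) where

  Least : ℕ → Set
  Least m = P m × (∀ m′ → m′ < m → ¬ P m′)

  least-below : ∀ b → (∃ λ m → m < b × Least m) ⊎ (∀ m → m < b → ¬ P m)
  least-below zero = inj₂ λ _ ()
  least-below (suc b) with least-below b
  ... | inj₁ (m , m<b , least) = inj₁ (m , m<n⇒m<1+n m<b , least)
  ... | inj₂ none with P? b
  ... | yes p = inj₁ (b , ≤-refl , p , none)
  ... | no ¬p = inj₂ λ m m<1+b p → contradiction p
          (case-≤ (m≤n⇒m<n∨m≡n (s≤s⁻¹ m<1+b)))
    where
    case-≤ : ∀ {m} → m < b ⊎ m ≡ b → ¬ P m
    case-≤ (inj₁ m<b)  = none _ m<b
    case-≤ (inj₂ refl) = ¬p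

  least : ∀ {b} → P b → ∃ λ m → m ≤ b × Least m
  least {b} p with least-below (suc b)
  ... | inj₁ (m , m<1+b , l) = m , s≤s⁻¹ m<1+b , l
  ... | inj₂ none            = contradiction p (none b ≤-refl)

module _ {k : ℕ} (1≤k : 1 ≤ k) where

  m≤m^k : ∀ m → 1 ≤ m → m ≤ m ^ k
  m≤m^k m 1≤m = go 1≤k
    where
    go : ∀ {k} → 1 ≤ k → m ≤ m ^ k
    go {suc k′} _ = ≤-trans (≤-reflexive (sym (*-identityʳ m))) (*-monoʳ-≤ m (m^n>0 m ⦃ >-nonZero 1≤m ⦄ k′))

  0^k : 0 ^ k ≡ 0
  0^k = go 1≤k
    where
    go : ∀ {k} → 1 ≤ k → 0 ^ k ≡ 0
    go {suc _} _ = refl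

  -- Take the least `t` with `q ≤ t ^ k`. For `t ≥ 2`, minimality bounds the power of `t - 1`, and
  -- `t ≤ 2 * (t - 1)` costs the factor `2 ^ k`.
  kth-root : ∀ q → 1 ≤ q → ∃ λ t → 1 ≤ t × q ≤ t ^ k × t ^ k ≤ 2 ^ k * q
  kth-root q 1≤q with least (λ t → q ≤? t ^ k) (m≤m^k q 1≤q)
  ... | zero , _ , q≤ , _ = contradiction (≤-trans 1≤q (≤-trans q≤ (≤-reflexive 0^k))) λ ()
  ... | suc zero , _ , q≤ , _ = 1 , ≤-refl , q≤ , ≤-trans (≤-reflexive (^-zeroˡ k)) (*-mono-≤ (m^n>0 2 k) 1≤q)
  ... | t@(suc t′@(suc t″)) , _ , q≤ , below = t , s≤s z≤n , q≤ , (begin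
      t ^ k          ≤⟨ ^-monoˡ-≤ k (s≤s (subst (t′ ≤_) (sym (+-suc t″ (t″ + 0))) (s≤s (m≤m+n t″ (t″ + 0))))) ⟩
      (2 * t′) ^ k   ≡⟨ ^-distribʳ-* k 2 t′ ⟩
      2 ^ k * t′ ^ k ≤⟨ *-monoʳ-≤ (2 ^ k) (<⇒≤ (≰⇒> (below t′ ≤-refl))) ⟩
      2 ^ k * q      ∎)
    where open ≤-Reasoning

  -- With `t` the rounded root of `Q * n`, the bound `R ≤ t ^ (k + 1)` is raised to the power `k`,
  -- which avoids fractional exponents: `R ^ k ≤ (t ^ k) ^ (k + 1)`.
  ramsey-bound : ∀ {r l} → 2 ≤ r → (Q : ℕ) ⦃ _ : NonZero Q ⦄ →
    (∀ n t → 1 ≤ t → Q * n ≤ t ^ k → Arrows r l n (t ^ suc k)) →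
    Σ ℕ λ C → 0 < C × (∀ n → Σ ℕ λ R → IsRamseyNumber r l n R × R ^ k ≤ C * n ^ (k + 1))
  ramsey-bound {r} {l} 2≤r Q arrows = C , m^n>0 (2 ^ k * Q) ⦃ m*n≢0 (2 ^ k) Q ⦃ m^n≢0 2 k ⦄ ⦄ (suc k) , number
    where
    C = (2 ^ k * Q) ^ suc k
    number : ∀ n → Σ ℕ λ R → IsRamseyNumber r l n R × R ^ k ≤ C * n ^ (k + 1)
    -- The root needs a positive argument. For `n = 0` the empty set is a blue clique, as it
    -- contains no edge.
    number zero = 0 , ((λ χ → inj₂ (⊥ , ∣⊥∣≡0 0 , λ e _ ∣e∣≡r → contradiction (≤-trans 2≤r (≤-reflexive (trans (sym ∣e∣≡r) (size0 e)))) λ ())) , λ _ ())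
                    , ≤-trans (≤-reflexive 0^k) z≤n
      where
      size0 : ∀ (e : Subset 0) → ∣ e ∣ ≡ 0
      size0 [] = refl
    number n@(suc _) with kth-root (Q * n) (*-mono-≤ (>-nonZero⁻¹ Q) (s≤s z≤n))
    ... | t , 1≤t , Qn≤ , ≤Qn with least (arrows? r l n) (arrows n t 1≤t Qn≤)
    ... | R , R≤ , isR = R , isR , (begin
        R ^ k                        ≤⟨ ^-monoˡ-≤ k R≤ ⟩
        (t ^ suc k) ^ k              ≡⟨ ^-*-assoc t (suc k) k ⟩
        t ^ (suc k * k)              ≡⟨ cong (t ^_) (*-comm (suc k) k) ⟩
        t ^ (k * suc k)              ≡⟨ ^-*-assoc t k (suc k) ⟨
        (t ^ k) ^ suc k              ≤⟨ ^-monoˡ-≤ (suc k) ≤Qn ⟩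
        (2 ^ k * (Q * n)) ^ suc k    ≡⟨ cong (_^ suc k) (*-assoc (2 ^ k) Q n) ⟨
        (2 ^ k * Q * n) ^ suc k      ≡⟨ ^-distribʳ-* (suc k) (2 ^ k * Q) n ⟩
        C * n ^ suc k                ≡⟨ cong (λ j → C * n ^ j) (+-comm k 1) ⟨
        C * n ^ (k + 1)              ∎)
      where open ≤-Reasoning

-- The upper bound

module UpperBound (r k L : ℕ) (2≤r : 2 ≤ r) (1≤L : 1 ≤ L) (2k≤1+L : k + k ≤ suc L) where

  -- `f` is the total size of the edges of the cycle, `D` bounds the union of the kernels through a
  -- pair of vertices, and `Q` is `ratio` without the factor `t`.
  l f D Q : ℕ
  l = 2 + L
  f = l * r
  D = coverSize r f r
  Q = (1 + suc k * r) * (L * suc (L * r * D))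

  instance
    Q≢0 : NonZero Q
    Q≢0 = m*n≢0 (1 + suc k * r) (L * suc (L * r * D)) ⦃ _ ⦄ ⦃ m*n≢0 L (suc (L * r * D)) ⦃ >-nonZero 1≤L ⦄ ⦄

  -- A red edge inside the first `n` vertices of `J` would contain a kernel inside `J`.
  clique : ∀ {n N} (χ : Colouring N) (J : List (Fin N)) → Unique J → n ≤ length J →
           (∀ {A} → Kernels.Kernel χ r f A → ¬ (∀ {v} → v ∈ A → v ∈ˡ J)) → BlueClique r n χ
  clique {n} {N} χ J unique n≤ independent =
    S , trans (∣fromList∣≡length (Uniqueₚ.take⁺ n unique)) (trans (length-take n J) (m≤n⇒m⊓n≡m n≤)) , blues
    where
    open Kernels χ r f
    S : Subset N
    S = fromList (take n J)
    blues : ∀ e → e ⊆ S → ∣ e ∣ ≡ r → χ e ≡ blue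
    blues e e⊆S ∣e∣≡r with χ e in eq
    ... | false = refl
    ... | true  =
      let A , A⊆e , kernel = contains-kernel _ ≤-refl (subst (2 ≤_) (sym ∣e∣≡r) 2≤r) (red⇒flexible (∣e∣≡r , eq))
      in ⊥-elim (independent kernel λ v∈A → take-⊆ n J (∈-fromList⁻ (take n J) (e⊆S (A⊆e v∈A))))
      where
      take-⊆ : ∀ n xs {v : Fin N} → v ∈ˡ take n xs → v ∈ˡ xs
      take-⊆ (suc n) (_ ∷ _) (here eq)  = here eq
      take-⊆ (suc n) (_ ∷ xs) (there i) = there (take-⊆ n xs i)

  independent-set : ∀ {N} (χ : Colouring N) t → 1 ≤ t → N ≤ t ^ suc k → ¬ RedLooseCycle r l χ →
    Σ (List (Fin N)) λ J → Unique J × (∀ {A} → Kernels.Kernel χ r f A → ¬ (∀ {v} → v ∈ A → v ∈ˡ J)) ×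
      N ≤ (1 + suc k * r) * t * (L * suc (L * r * D)) * length J
  independent-set {N} χ t 1≤t N≤ ¬cyc =
    let J , unique , _ , independent , bound = large-independent k t L 1≤L 2k≤1+L 1≤t N≤
          (λ cyc → ¬cyc (kernel-cycle⇒red-cycle ≤-refl (s≤s (s≤s 1≤L)) cyc)) _ (allFin N) ≤-refl (Uniqueₚ.allFin⁺ N)
    in J , unique , independent , ≤-trans (≤-reflexive (sym (length-tabulate {n = N} id))) bound
    where
    open Kernels χ r f
    open BoundedCodegree Kernel kernel? r D (λ kernel → flexible-size (proj₁ (proj₂ kernel))) proj₁
           pairCover (λ x y → length-kernelCover r _) ∈-pairCover

  arrows : ∀ n t → 1 ≤ t → Q * n ≤ t ^ k → Arrows r l n (t ^ suc k)
  arrows n t 1≤t Qn≤ χ = cycle-or-clique (redLooseCycle? r l χ)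
    where
    -- Cancelling `t` gives `t ^ k ≤ Q * j`, and `Q * n ≤ t ^ k` then yields `n ≤ j`.
    large : ∀ j → t * t ^ k ≤ (1 + suc k * r) * t * (L * suc (L * r * D)) * j → n ≤ j
    large j bound = *-cancelˡ-≤ Q (≤-trans Qn≤ (*-cancelˡ-≤ t ⦃ >-nonZero 1≤t ⦄ (begin
      t * t ^ k                                          ≤⟨ bound ⟩
      (1 + suc k * r) * t * (L * suc (L * r * D)) * j    ≡⟨ cong (λ q → q * (L * suc (L * r * D)) * j) (*-comm (1 + suc k * r) t) ⟩
      t * (1 + suc k * r) * (L * suc (L * r * D)) * j    ≡⟨ cong (_* j) (*-assoc t (1 + suc k * r) (L * suc (L * r * D))) ⟩
      t * Q * j                                          ≡⟨ *-assoc t Q j ⟩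
      t * (Q * j)                                        ∎)))
      where open ≤-Reasoning
    cycle-or-clique : Dec (RedLooseCycle r l χ) → RedLooseCycle r l χ ⊎ BlueClique r n χ
    cycle-or-clique (yes cyc) = inj₁ cyc
    cycle-or-clique (no ¬cyc) =
      let J , unique , independent , bound = independent-set χ t 1≤t ≤-refl ¬cyc
      in inj₂ (clique χ J unique (large (length J) bound) independent)

theorem1p6 : ∀ (r l : ℕ) → 3 ≤ r → 5 ≤ l → l % 2 ≡ 1 →
    Σ ℕ λ C → 0 < C × (∀ (n : ℕ) → Σ ℕ λ R →
    IsRamseyNumber r l n R × R ^ (l / 2) ≤ C * n ^ (l / 2 + 1))
theorem1p6 r l@(suc (suc L)) 3≤r (s≤s (s≤s 3≤L)) odd =
  ramsey-bound 1≤k 2≤r (UpperBound.Q r k L 2≤r 1≤L 2k≤1+L) ⦃ UpperBound.Q≢0 r k L 2≤r 1≤L 2k≤1+L ⦄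
    (UpperBound.arrows r k L 2≤r 1≤L 2k≤1+L)
  where
  k = l / 2
  -- Oddness gives `l = 2k + 1`, while `l = L + 2`.
  2k≡1+L : k + k ≡ suc L
  2k≡1+L = suc-injective (sym (trans (m≡m%n+[m/n]*n l 2)
    (trans (cong (_+ k * 2) odd) (cong suc (trans (*-comm k 2) (cong (k +_) (+-identityʳ k)))))))
  2≤r : 2 ≤ r
  2≤r = <⇒≤ 3≤r
  1≤L : 1 ≤ L
  1≤L = ≤-trans (s≤s z≤n) 3≤L
  2k≤1+L : k + k ≤ suc L
  2k≤1+L = ≤-reflexive 2k≡1+L
  1≤k : 1 ≤ k
  1≤k = n≢0⇒n>0 λ k≡0 → 0≢1+n (trans (sym (cong₂ _+_ k≡0 k≡0)) 2k≡1+L)
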